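{- Let $G$ be a König–Egerváry graph and $G_0=G-N[\mathrm{core}(G)]$. Then the following are equivalent: (i) $G_0$ has a unique perfect matching; (ii) the $\alpha$-critical edges of $G_0$ form a maximal matching in $G_0$; (iii) $\xi(G)+\eta(G)=\alpha(G)$; (iv) $\sigma(G)+\eta(G)=\mu(G)$; (v) $\xi(G)+2\eta(G)+\sigma(G)=n(G)$.
   Context: All graphs are finite and simple; "graph" means a connected graph with at least one edge ($G_0$ need not be connected; definitions apply to it as well). $\alpha(G)$ is the stability number, $\mu(G)$ the maximum matching size, $n(G)=|V(G)|$; $G$ is König–Egerváry if $\alpha(G)+\mu(G)=n(G)$. $\Omega(G)$ is the set of maximum stable sets, $\mathrm{core}(G)=\bigcap\{S:S\in\Omega(G)\}$, $\xi(G)=|\mathrm{core}(G)|$, $\sigma(G)=\left|\bigcap\{V(G)-S:S\in\Omega(G)\}\right|$. For $A\subseteq V(G)$, $N(A)$ is the set of vertices adjacent to some vertex of $A$, $N[A]=A\cup N(A)$, and $G-A$ is the subgraph induced by $V(G)-A$. An edge $e$ of a graph $H$ is $\alpha$-critical in $H$ if $\alpha(H-e)>\alpha(H)$ ($H-e$ being $H$ with $e$ deleted); $\eta(G)$ is the number of $\alpha$-critical edges of $G$. A maximal matching is one not properly contained in another matching. -}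

module Defs where

open import Data.Nat using (ℕ; zero; suc; _+_; _*_; _⊔_; _≤ᵇ_; _<ᵇ_; _≡ᵇ_)
open import Data.Bool using (Bool; true; false; _∧_; _∨_; not; T)
open import Data.Bool.Properties using (∧-comm; ∨-comm; T?)
open import Data.Fin using (Fin; toℕ)
open import Data.Fin.Properties using (_≟_)
open import Data.List using (List; []; _∷_; map; filter; length; foldr; concatMap; allFin; lookup; _++_)
open import Data.Bool.ListAction using () renaming (all to allL; any to anyL)
open import Data.List.Membership.Propositional using (_∈_; _∉_)
open import Data.Vec using (Vec)
import Data.Vec as V
open import Data.Fin.Subset using (Subset; ∣_∣)
open import Data.Product using (Σ; _×_; _,_; proj₁; proj₂; ∃-syntax)
open import Relation.Nullary using (¬_)
open import Relation.Nullary.Decidable using (⌊_⌋)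
open import Relation.Binary.PropositionalEquality using (_≡_; refl; cong₂; trans; sym)
open import Function.Bundles using (_⇔_)

record Graph (n : ℕ) : Set where
  field
    adj    : Fin n → Fin n → Bool
    adj-sym    : ∀ u v → adj u v ≡ adj v u
    adj-irrefl : ∀ v → adj v v ≡ false
open Graph public

data Reach {n : ℕ} (G : Graph n) : Fin n → Fin n → Set where
  here : ∀ {v} → Reach G v v
  step : ∀ {u w v} → adj G u w ≡ true → Reach G w v → Reach G u v

Connected : {n : ℕ} → Graph n → Set
Connected G = ∀ u v → Reach G u v

HasEdge : {n : ℕ} → Graph n → Set
HasEdge G = ∃[ u ] ∃[ v ] (adj G u v ≡ true)

allV : {n : ℕ} → (Fin n → Bool) → Bool
allV {n} p = allL p (allFin n)

anyV : {n : ℕ} → (Fin n → Bool) → Bool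
anyV {n} p = anyL p (allFin n)

countV : {n : ℕ} → (Fin n → Bool) → ℕ
countV {n} p = length (filter (λ v → T? (p v)) (allFin n))

_==_ : {n : ℕ} → Fin n → Fin n → Bool
u == v = ⌊ u ≟ v ⌋

maxList : List ℕ → ℕ
maxList = foldr _⊔_ 0

allSubsets : (n : ℕ) → List (Subset n)
allSubsets zero    = V.[] ∷ []
allSubsets (suc n) = map (true V.∷_) (allSubsets n) ++ map (false V.∷_) (allSubsets n)

_∈ˢ_ : {n : ℕ} → Fin n → Subset n → Bool
v ∈ˢ S = V.lookup S v

module _ {n : ℕ} (G : Graph n) where

  isStable : Subset n → Bool
  isStable S = allV (λ u → allV (λ v → not (u ∈ˢ S ∧ v ∈ˢ S ∧ adj G u v)))

  α : ℕ
  α = maxList (map ∣_∣ (filter (λ S → T? (isStable S)) (allSubsets n)))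

  isMaxStable : Subset n → Bool
  isMaxStable S = isStable S ∧ (∣ S ∣ ≡ᵇ α)

  inCore : Fin n → Bool
  inCore v = allL (λ S → not (isMaxStable S) ∨ (v ∈ˢ S)) (allSubsets n)

  inNoMaxStable : Fin n → Bool
  inNoMaxStable v = allL (λ S → not (isMaxStable S) ∨ not (v ∈ˢ S)) (allSubsets n)

  ξ : ℕ
  ξ = countV inCore

  σ : ℕ
  σ = countV inNoMaxStable

  inClosedNbhdCore : Fin n → Bool
  inClosedNbhdCore v = inCore v ∨ anyV (λ u → inCore u ∧ adj G u v)

-- Edges and matchings.  An edge is stored as an ordered pair (u , v) with
-- u < v, so that each edge has exactly one representation.

Edge : ℕ → Set
Edge n = Fin n × Fin n

module _ {n : ℕ} (G : Graph n) where

  isEdge : Edge n → Bool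
  isEdge (u , v) = (toℕ u <ᵇ toℕ v) ∧ adj G u v

  edgeList : List (Edge n)
  edgeList = filter (λ e → T? (isEdge e))
                    (concatMap (λ u → map (u ,_) (allFin n)) (allFin n))

  covers : Edge n → Fin n → Bool
  covers (u , v) w = (u == w) ∨ (v == w)

  -- a matching: a list of edges of G, every vertex covered at most once
  -- (this also rules out repeated edges)
  isMatching : List (Edge n) → Bool
  isMatching M = allL isEdge M ∧
                 allV (λ w → length (filter (λ e → T? (covers e w)) M) ≤ᵇ 1)

  Matching : List (Edge n) → Set
  Matching M = isMatching M ≡ true

  -- maximum matching size μ(G); every matching is, up to order, a
  -- sublist of edgeList, so it suffices to range over those
  sublists : {A : Set} → List A → List (List A)
  sublists []       = [] ∷ []
  sublists (x ∷ xs) = map (x ∷_) (sublists xs) ++ sublists xs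

  μ : ℕ
  μ = maxList (map length (filter (λ M → T? (isMatching M)) (sublists edgeList)))

  PerfectMatching : List (Edge n) → Set
  PerfectMatching M = Matching M × (∀ w → anyL (λ e → covers e w) M ≡ true)

  UniquePerfectMatching : Set
  UniquePerfectMatching =
    Σ (List (Edge n)) λ M → PerfectMatching M ×
      (∀ M′ → PerfectMatching M′ → ∀ e → (e ∈ M′) ⇔ (e ∈ M))

  MaximalMatching : List (Edge n) → Set
  MaximalMatching M = Matching M ×
    (∀ e → isEdge e ≡ true → e ∉ M → ¬ Matching (e ∷ M))

sameEdge : {n : ℕ} → Edge n → Fin n → Fin n → Bool
sameEdge (a , b) x y = (x == a ∧ y == b) ∨ (x == b ∧ y == a)

sameEdge-sym : {n : ℕ} (e : Edge n) (x y : Fin n) → sameEdge e x y ≡ sameEdge e y x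
sameEdge-sym (a , b) x y = ∨-comm (x == a ∧ y == b) (x == b ∧ y == a)
  |> λ p → trans p (cong₂ _∨_ (∧-comm (x == b) (y == a)) (∧-comm (x == a) (y == b)))
  where
  _|>_ : {A B : Set} → A → (A → B) → B
  x |> f = f x

deleteEdge : {n : ℕ} → Graph n → Edge n → Graph n
deleteEdge G e = record
  { adj    = λ x y → adj G x y ∧ not (sameEdge e x y)
  ; adj-sym    = λ x y → cong₂ (λ p q → p ∧ not q) (adj-sym G x y) (sameEdge-sym e x y)
  ; adj-irrefl = λ x → cong₂ (λ p q → p ∧ not q) (adj-irrefl G x) refl
  }

module _ {n : ℕ} (G : Graph n) where

  isCritical : Edge n → Bool
  isCritical e = α G <ᵇ α (deleteEdge G e)

  criticalEdges : List (Edge n)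
  criticalEdges = filter (λ e → T? (isCritical e)) (edgeList G)

  η : ℕ
  η = length criticalEdges

module _ {n : ℕ} (G : Graph n) (keep : Fin n → Bool) where

  keptVertices : List (Fin n)
  keptVertices = filter (λ v → T? (keep v)) (allFin n)

  induced : Graph (length keptVertices)
  induced = record
    { adj    = λ i j → adj G (lookup keptVertices i) (lookup keptVertices j)
    ; adj-sym    = λ i j → adj-sym G (lookup keptVertices i) (lookup keptVertices j)
    ; adj-irrefl = λ i → adj-irrefl G (lookup keptVertices i)
    }

G₀size : {n : ℕ} → Graph n → ℕ
G₀size G = length (keptVertices G (λ v → not (inClosedNbhdCore G v)))

G₀ : {n : ℕ} (G : Graph n) → Graph (G₀size G)
G₀ G = induced G (λ v → not (inClosedNbhdCore G v))

KonigEgervary : {n : ℕ} → Graph n → Set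
KonigEgervary {n} G = α G + μ G ≡ n

{-# OPTIONS --safe #-}
module Submission where

-- View a maximum matching M of the König–Egerváry graph G as an involution. Counting shows that M matches the
-- complement of every maximum stable set into that set. Hence the vertices lying in no maximum stable set are
-- exactly those of N(core G), M restricts to a perfect matching of G₀, and h = α(G₀) = |G₀| / 2 satisfies
-- α = ξ + h, μ = σ + h and n = ξ + σ + 2h. An α-critical edge uv comes with a set T of size α + 1 inducing only the
-- edge uv; both T - u and T - v are maximum stable, so uv lies in G₀ and in every maximum matching. Thus G and G₀
-- have the same critical edges, these form a matching, and each of (i)–(v) says that they cover all of G₀.
--
-- The one harder step is that a unique perfect matching p of G₀ consists of critical edges. Given u, take maximum
-- stable sets S ∋ u and S′ ∋ p u, and let W ⊆ S be the least set containing u and every s ∈ S adjacent to a vertex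
-- of p(W). If u p(u) is the only edge from u to p(W), then (S ∖ W) ∪ p(W) ∪ {u} witnesses that it is critical;
-- any other edge from u to p(W) closes an alternating cycle, and switching along it gives another perfect matching.

open import Defs
open import Data.Nat using (ℕ; zero; suc; _+_; _*_; _≤_; _<_; z≤n; s≤s; s≤s⁻¹; _≤ᵇ_; _<ᵇ_)
open import Data.Product using (∃; _×_; _,_; proj₁; proj₂)
open import Function.Bundles using (_⇔_; mk⇔; Equivalence)
open import Relation.Binary.PropositionalEquality
  using (_≡_; _≢_; refl; sym; trans; cong; cong₂; subst; subst₂; module ≡-Reasoning)
open import Data.Nat.Properties as ℕₚ
  using (+-0-commutativeMonoid; ≤-refl; ≤-trans; ≤-reflexive; ≤-antisym; +-mono-≤; +-monoˡ-≤; +-monoʳ-≤; +-cancelˡ-≤;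
         +-cancelʳ-≤; +-cancelˡ-≡; m≤m⊔n; m≤n⊔m; ⊔-sel)
open import Algebra.Properties.CommutativeMonoid.Sum +-0-commutativeMonoid
  using (sum; ∑-distrib-+; sum-permute; sum-cong-≗; sum-replicate-zero)
open import Data.Bool using (Bool; true; false; _∧_; _∨_; not; T; if_then_else_)
import Data.Bool as Bool
open import Data.Bool.ListAction using () renaming (all to allL; any to anyL)
open import Data.Bool.Properties using (T?; T-≡)
open import Data.Empty using (⊥; ⊥-elim)
open import Data.Fin using (Fin; zero; suc; toℕ)
open import Data.Fin.Permutation using (permutation)
open import Data.Fin.Permutation.Components using (transpose; transpose-inverse)
open import Data.Fin.Properties using (_≟_; any?; toℕ-injective)
open import Data.Fin.Subset using (Subset; ∣_∣)
open import Data.List using (List; []; _∷_; _++_; map; filter; length; tabulate; lookup; allFin;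
  concatMap; cartesianProduct)
open import Data.List.Membership.Propositional using (_∈_)
open import Data.List.Membership.Propositional.Properties
  using (∈-filter⁺; ∈-filter⁻; ∈-map⁺; ∈-++⁺ˡ; ∈-++⁺ʳ; ∈-allFin; ∈-cartesianProduct⁺; ∈-length; ∈-lookup)
open import Data.List.Relation.Unary.All as All using ()
open import Data.List.Relation.Unary.AllPairs using (_∷_)
open import Data.List.Relation.Unary.Any using (here; there; index)
open import Data.List.Relation.Unary.Any.Properties using (lookup-index)
open import Data.List.Relation.Unary.Unique.Propositional using (Unique)
import Data.List.Relation.Unary.Unique.Propositional.Properties as Uniqueₚ
open import Data.Nat.Tactic.RingSolver using (solve-∀)
open import Data.Sum as Sum using (_⊎_; inj₁; inj₂)
import Data.Vec as V
import Data.Vec.Properties as Vₚ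
open import Function using (_∘_; case_of_)
open import Relation.Binary using (tri<; tri≈; tri>)
open import Relation.Nullary using (¬_; Dec; yes; no)
open import Relation.Nullary.Decidable using (dec-true; dec-false)

-- Boolean tests and their logical meaning

private
  variable
    n : ℕ
    A : Set

true≢false : ∀ {b} → b ≡ true → b ≡ false → ⊥
true≢false refl ()

bool-cases : ∀ b → b ≡ true ⊎ b ≡ false
bool-cases true  = inj₁ refl
bool-cases false = inj₂ refl

bool-ext : ∀ {a b} → (a ≡ true → b ≡ true) → (b ≡ true → a ≡ true) → a ≡ b
bool-ext {true}          f g = sym (f refl)
bool-ext {false} {true}  f g = g refl
bool-ext {false} {false} f g = refl

≢true⇒≡false : ∀ {b} → ¬ b ≡ true → b ≡ false
≢true⇒≡false {true}  h = ⊥-elim (h refl)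
≢true⇒≡false {false} h = refl

not-true⁻ : ∀ {b} → not b ≡ true → b ≡ false
not-true⁻ {false} _ = refl

not-false⁻ : ∀ {b} → not b ≡ false → b ≡ true
not-false⁻ {true} _ = refl

T⁺ : ∀ {b} → b ≡ true → T b
T⁺ = Equivalence.from T-≡

T⁻ : ∀ {b} → T b → b ≡ true
T⁻ = Equivalence.to T-≡

∧-true⁻ : ∀ a {b} → a ∧ b ≡ true → a ≡ true × b ≡ true
∧-true⁻ true h = refl , h

∧-true⁺ : ∀ {a b} → a ≡ true → b ≡ true → a ∧ b ≡ true
∧-true⁺ refl refl = refl

∨-true⁻ : ∀ a {b} → a ∨ b ≡ true → a ≡ true ⊎ b ≡ true
∨-true⁻ true  h = inj₁ refl
∨-true⁻ false h = inj₂ h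

∨-true⁺ˡ : ∀ {a} b → a ≡ true → a ∨ b ≡ true
∨-true⁺ˡ b refl = refl

∨-true⁺ʳ : ∀ a {b} → b ≡ true → a ∨ b ≡ true
∨-true⁺ʳ true  refl = refl
∨-true⁺ʳ false refl = refl

==-true⁻ : {x y : Fin n} → (x == y) ≡ true → x ≡ y
==-true⁻ {x = x} {y} h with x ≟ y
... | yes p = p
... | no _  = case h of λ ()

==-refl : (x : Fin n) → (x == x) ≡ true
==-refl x with x ≟ x
... | yes _ = refl
... | no ¬p = ⊥-elim (¬p refl)

==-false : {x y : Fin n} → x ≢ y → (x == y) ≡ false
==-false h = ≢true⇒≡false (h ∘ ==-true⁻)

==-true⁺ : {x y : Fin n} → x ≡ y → (x == y) ≡ true
==-true⁺ {x = x} refl = ==-refl x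

all-true⁻ : (p : A → Bool) (xs : List A) → allL p xs ≡ true → ∀ {x} → x ∈ xs → p x ≡ true
all-true⁻ p (x ∷ xs) h (here refl) = proj₁ (∧-true⁻ (p x) h)
all-true⁻ p (x ∷ xs) h (there x∈)  = all-true⁻ p xs (proj₂ (∧-true⁻ (p x) h)) x∈

all-true⁺ : (p : A → Bool) (xs : List A) → (∀ {x} → x ∈ xs → p x ≡ true) → allL p xs ≡ true
all-true⁺ p []       h = refl
all-true⁺ p (x ∷ xs) h = ∧-true⁺ (h (here refl)) (all-true⁺ p xs (h ∘ there))

all-false⁻ : (p : A → Bool) (xs : List A) → allL p xs ≡ false → ∃ λ x → x ∈ xs × p x ≡ false
all-false⁻ p (x ∷ xs) h with p x in eq
... | false = x , here refl , eq
... | true  = let y , y∈ , py = all-false⁻ p xs h in y , there y∈ , py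

any-true⁻ : (p : A → Bool) (xs : List A) → anyL p xs ≡ true → ∃ λ x → x ∈ xs × p x ≡ true
any-true⁻ p (x ∷ xs) h with p x in eq
... | true  = x , here refl , eq
... | false = let y , y∈ , py = any-true⁻ p xs h in y , there y∈ , py

any-true⁺ : (p : A → Bool) (xs : List A) {x : A} → x ∈ xs → p x ≡ true → anyL p xs ≡ true
any-true⁺ p (x ∷ xs) (here refl) h = ∨-true⁺ˡ _ h
any-true⁺ p (x ∷ xs) (there x∈)  h = ∨-true⁺ʳ (p x) (any-true⁺ p xs x∈ h)

allV-true⁻ : (p : Fin n → Bool) → allV p ≡ true → ∀ x → p x ≡ true
allV-true⁻ {n} p h x = all-true⁻ p (allFin n) h (∈-allFin x)

allV-true⁺ : (p : Fin n → Bool) → (∀ x → p x ≡ true) → allV p ≡ true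
allV-true⁺ {n} p h = all-true⁺ p (allFin n) (λ {x} _ → h x)

anyV-true⁻ : (p : Fin n → Bool) → anyV p ≡ true → ∃ λ x → p x ≡ true
anyV-true⁻ {n} p h = let x , _ , px = any-true⁻ p (allFin n) h in x , px

anyV-true⁺ : (p : Fin n → Bool) → ∀ x → p x ≡ true → anyV p ≡ true
anyV-true⁺ p x = any-true⁺ p _ (∈-allFin x)

-- Counting

sum-mono : {f g : Fin n → ℕ} → (∀ x → f x ≤ g x) → sum f ≤ sum g
sum-mono {zero}  h = z≤n
sum-mono {suc n} h = +-mono-≤ (h zero) (sum-mono (h ∘ suc))

-- Cancelling the inequality of the tails from `sum g ≤ sum f` leaves `g zero ≤ f zero`; cancelling
-- that of the heads leaves the premise of the recursive call. Tight counts become pointwise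
-- statements in this way.
sum-squeeze : {f g : Fin n → ℕ} → (∀ x → f x ≤ g x) → sum g ≤ sum f → ∀ x → f x ≡ g x
sum-squeeze {suc n} {f} {g} h le zero = ≤-antisym (h zero)
  (+-cancelʳ-≤ (sum (f ∘ suc)) (g zero) (f zero)
    (≤-trans (+-monoʳ-≤ (g zero) (sum-mono (h ∘ suc))) le))
sum-squeeze {suc n} {f} {g} h le (suc x) = sum-squeeze (h ∘ suc)
  (+-cancelˡ-≤ (f zero) _ _ (≤-trans (+-monoˡ-≤ _ (h zero)) le)) x

sum-involution : (q : Fin n → Fin n) → (∀ x → q (q x) ≡ x) → (f : Fin n → ℕ) → sum (f ∘ q) ≡ sum f
sum-involution q q-inv f = sym (sum-permute f (permutation q q q-inv q-inv))

⟦_⟧ : Bool → ℕ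
⟦ true  ⟧ = 1
⟦ false ⟧ = 0

count : (Fin n → Bool) → ℕ
count f = sum (λ x → ⟦ f x ⟧)

⟦⟧-mono : ∀ {a b} → (a ≡ true → b ≡ true) → ⟦ a ⟧ ≤ ⟦ b ⟧
⟦⟧-mono {false} h = z≤n
⟦⟧-mono {true}  h rewrite h refl = ≤-refl

⟦⟧-injective : ∀ {a b} → ⟦ a ⟧ ≡ ⟦ b ⟧ → a ≡ b
⟦⟧-injective {true}  {true}  h = refl
⟦⟧-injective {false} {false} h = refl

count-mono : {f g : Fin n → Bool} → (∀ x → f x ≡ true → g x ≡ true) → count f ≤ count g
count-mono h = sum-mono (λ x → ⟦⟧-mono (h x))

count-cong : {f g : Fin n → Bool} → (∀ x → f x ≡ g x) → count f ≡ count g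
count-cong h = sum-cong-≗ (cong ⟦_⟧ ∘ h)

count-true : ∀ n → count {n} (λ _ → true) ≡ n
count-true zero    = refl
count-true (suc n) = cong suc (count-true n)

count-false : ∀ n → count {n} (λ _ → false) ≡ 0
count-false n = sum-replicate-zero n

count-split : {f g h : Fin n → Bool} → (∀ x → ⟦ f x ⟧ ≡ ⟦ g x ⟧ + ⟦ h x ⟧) → count f ≡ count g + count h
count-split {g = g} {h} e = trans (sum-cong-≗ e) (∑-distrib-+ (⟦_⟧ ∘ g) (⟦_⟧ ∘ h))

count-not : (f : Fin n → Bool) → count f + count (not ∘ f) ≡ n
count-not {n} f = trans (sym (count-split {f = λ _ → true} {f} {not ∘ f} (λ x → lemma (f x)))) (count-true n)
  where
  lemma : ∀ b → 1 ≡ ⟦ b ⟧ + ⟦ not b ⟧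
  lemma true  = refl
  lemma false = refl

count-singleton : (u : Fin n) → count (u ==_) ≡ 1
count-singleton {suc n} zero    = cong suc (count-false n)
count-singleton {suc n} (suc u) = trans (count-cong shift) (count-singleton u)
  where
  shift : ∀ x → (suc u == suc x) ≡ (u == x)
  shift x with u ≟ x
  ... | yes _ = refl
  ... | no  _ = refl

length-filter : (p : A → Bool) (t : Fin n → A) → length (filter (λ v → T? (p v)) (tabulate t)) ≡ count (p ∘ t)
length-filter {n = zero}  p t = refl
length-filter {n = suc n} p t with p (t zero)
... | true  = cong suc (length-filter p (t ∘ suc))
... | false = length-filter p (t ∘ suc)

countV≡count : (f : Fin n → Bool) → countV f ≡ count f
countV≡count f = length-filter f (λ x → x)

∣∣≡count : (S : Subset n) → ∣ S ∣ ≡ count (V.lookup S)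
∣∣≡count V.[]            = refl
∣∣≡count (true V.∷ S)    = cong suc (∣∣≡count S)
∣∣≡count (false V.∷ S)   = ∣∣≡count S

∣tabulate∣ : (f : Fin n → Bool) → ∣ V.tabulate f ∣ ≡ count f
∣tabulate∣ f = trans (∣∣≡count (V.tabulate f)) (count-cong (Vₚ.lookup∘tabulate f))

-- Stable sets

∈-allSubsets : (S : Subset n) → S ∈ allSubsets n
∈-allSubsets V.[]          = here refl
∈-allSubsets (true V.∷ S)  = ∈-++⁺ˡ (∈-map⁺ _ (∈-allSubsets S))
∈-allSubsets (false V.∷ S) = ∈-++⁺ʳ _ (∈-map⁺ _ (∈-allSubsets S))

maxList-upper : (h : A → ℕ) (xs : List A) {x : A} → x ∈ xs → h x ≤ maxList (map h xs)
maxList-upper h (x ∷ xs) (here refl) = m≤m⊔n _ _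
maxList-upper h (x ∷ xs) (there x∈)  = ≤-trans (maxList-upper h xs x∈) (m≤n⊔m (h x) _)

maxList-attained : (h : A → ℕ) (xs : List A) → maxList (map h xs) ≡ 0 ⊎ ∃ λ x → x ∈ xs × h x ≡ maxList (map h xs)
maxList-attained h []       = inj₁ refl
maxList-attained h (x ∷ xs) with ⊔-sel (h x) (maxList (map h xs))
... | inj₁ e = inj₂ (x , here refl , sym e)
... | inj₂ e with maxList-attained h xs
...   | inj₁ z              = inj₁ (trans e z)
...   | inj₂ (y , y∈ , eq)  = inj₂ (y , there y∈ , trans eq (sym e))

-- Sets are Boolean functions rather than `Subset` vectors, so that they can be composed with
-- involutions and with the embedding of an induced subgraph.
Stable : Graph n → (Fin n → Bool) → Set
Stable G f = ∀ x y → f x ≡ true → f y ≡ true → adj G x y ≡ false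

-- Only the lower bound is demanded, since stability already gives `count f ≤ α G`.
MaxStable : Graph n → (Fin n → Bool) → Set
MaxStable G f = Stable G f × α G ≤ count f

module _ (G : Graph n) where

  isStable⁻ : (S : Subset n) → isStable G S ≡ true → Stable G (V.lookup S)
  isStable⁻ S h x y fx fy with allV-true⁻ _ (allV-true⁻ _ h x) y
  ... | e rewrite fx | fy = not-true⁻ e

  isStable⁺ : (S : Subset n) → Stable G (V.lookup S) → isStable G S ≡ true
  isStable⁺ S h = allV-true⁺ _ λ x → allV-true⁺ _ λ y → lemma x y
    where
    lemma : ∀ x y → not (x ∈ˢ S ∧ y ∈ˢ S ∧ adj G x y) ≡ true
    lemma x y with V.lookup S x in fx | V.lookup S y in fy
    ... | false | _     = refl
    ... | true  | false = refl
    ... | true  | true  = cong not (h x y fx fy)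

  isStable-tabulate : {f : Fin n → Bool} → Stable G f → isStable G (V.tabulate f) ≡ true
  isStable-tabulate {f} st = isStable⁺ (V.tabulate f) λ x y fx fy →
    st x y (trans (sym (Vₚ.lookup∘tabulate f x)) fx) (trans (sym (Vₚ.lookup∘tabulate f y)) fy)

  Stable⇒count≤α : {f : Fin n → Bool} → Stable G f → count f ≤ α G
  Stable⇒count≤α {f} st = subst (_≤ α G) (∣tabulate∣ f)
    (maxList-upper ∣_∣ _ (∈-filter⁺ (λ S → T? (isStable G S)) (∈-allSubsets (V.tabulate f)) (T⁺ (isStable-tabulate st))))

  maxStable-exists : ∃ (MaxStable G)
  maxStable-exists with maxList-attained ∣_∣ (filter (λ S → T? (isStable G S)) (allSubsets n))
  -- `maxList` of an empty list is 0, so the value 0 need not come from a listed set; the empty set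
  -- attains it.
  ... | inj₁ α≡0           = (λ _ → false) , (λ _ _ ()) , subst (_≤ count {n} (λ _ → false)) (sym α≡0) z≤n
  ... | inj₂ (S , S∈ , eq) = V.lookup S ,
      isStable⁻ S (T⁻ (proj₂ (∈-filter⁻ (λ S → T? (isStable G S)) {xs = allSubsets n} S∈))) ,
      ≤-reflexive (trans (sym eq) (∣∣≡count S))

  MaxStable⇒count≡α : {f : Fin n → Bool} → MaxStable G f → count f ≡ α G
  MaxStable⇒count≡α (st , le) = ≤-antisym (Stable⇒count≤α st) le

  isMaxStable⁻ : (S : Subset n) → isMaxStable G S ≡ true → MaxStable G (V.lookup S)
  isMaxStable⁻ S h = let a , b = ∧-true⁻ (isStable G S) h in
    isStable⁻ S a , ≤-reflexive (trans (sym (ℕₚ.≡ᵇ⇒≡ _ _ (T⁺ b))) (∣∣≡count S))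

  isMaxStable-tabulate : {f : Fin n → Bool} → MaxStable G f → isMaxStable G (V.tabulate f) ≡ true
  isMaxStable-tabulate {f} m@(st , _) = ∧-true⁺ (isStable-tabulate st)
    (T⁻ (ℕₚ.≡⇒≡ᵇ _ _ (trans (∣tabulate∣ f) (MaxStable⇒count≡α m))))

  -- `c` is the identity for `inCore` and `not` for `inNoMaxStable`, so that one argument serves
  -- both tests.
  all-MaxStable⁻ : {x : Fin n} (c : Bool → Bool) →
    allL (λ S → not (isMaxStable G S) ∨ c (x ∈ˢ S)) (allSubsets n) ≡ true →
    ∀ {f} → MaxStable G f → c (f x) ≡ true
  all-MaxStable⁻ {x} c h {f} m with all-true⁻ _ (allSubsets n) h (∈-allSubsets (V.tabulate f))
  ... | e rewrite isMaxStable-tabulate m = trans (cong c (sym (Vₚ.lookup∘tabulate f x))) e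

  all-MaxStable-false⁻ : {x : Fin n} (c : Bool → Bool) →
    allL (λ S → not (isMaxStable G S) ∨ c (x ∈ˢ S)) (allSubsets n) ≡ false →
    ∃ λ f → MaxStable G f × c (f x) ≡ false
  all-MaxStable-false⁻ {x} c h with all-false⁻ _ (allSubsets n) h
  ... | S , _ , e with isMaxStable G S in eq
  ...   | true = V.lookup S , isMaxStable⁻ S eq , e

  inCore⁻ : {x : Fin n} → inCore G x ≡ true → ∀ {f} → MaxStable G f → f x ≡ true
  inCore⁻ = all-MaxStable⁻ (λ b → b)

  inCore-false⁻ : {x : Fin n} → inCore G x ≡ false → ∃ λ f → MaxStable G f × f x ≡ false
  inCore-false⁻ = all-MaxStable-false⁻ (λ b → b)

  inCore⁺ : {x : Fin n} → (∀ {f} → MaxStable G f → f x ≡ true) → inCore G x ≡ true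
  inCore⁺ {x} h with inCore G x in eq
  ... | true  = refl
  ... | false = let f , m , fx = inCore-false⁻ eq in sym (trans (sym (h m)) fx)

  inNoMaxStable⁻ : {x : Fin n} → inNoMaxStable G x ≡ true → ∀ {f} → MaxStable G f → f x ≡ false
  inNoMaxStable⁻ h m = not-true⁻ (all-MaxStable⁻ not h m)

  inNoMaxStable-false⁻ : {x : Fin n} → inNoMaxStable G x ≡ false → ∃ λ f → MaxStable G f × f x ≡ true
  inNoMaxStable-false⁻ h = let f , m , e = all-MaxStable-false⁻ not h in f , m , not-false⁻ e

  inNoMaxStable⁺ : {x : Fin n} → (∀ {f} → MaxStable G f → f x ≡ false) → inNoMaxStable G x ≡ true
  inNoMaxStable⁺ {x} h with inNoMaxStable G x in eq
  ... | true  = refl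
  ... | false = let f , m , fx = inNoMaxStable-false⁻ eq in trans (sym (h m)) fx

-- Matchings

length≤1⇒≡ : {xs : List A} → length xs ≤ 1 → ∀ {x y} → x ∈ xs → y ∈ xs → x ≡ y
length≤1⇒≡ {xs = _ ∷ []} _ (here refl) (here refl) = refl
length≤1⇒≡ {xs = _ ∷ _ ∷ _} (s≤s ()) _ _

≡⇒length≤1 : {xs : List A} → Unique xs → (∀ {x y} → x ∈ xs → y ∈ xs → x ≡ y) → length xs ≤ 1
≡⇒length≤1 {xs = []}         _ _ = z≤n
≡⇒length≤1 {xs = _ ∷ []}     _ _ = s≤s z≤n
≡⇒length≤1 {xs = _ ∷ _ ∷ _} ((x≢y All.∷ _) ∷ _) h = ⊥-elim (x≢y (h (here refl) (there (here refl))))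

concatMap≡cartesianProduct : {B : Set} (xs : List A) (ys : List B) →
  concatMap (λ x → map (x ,_) ys) xs ≡ cartesianProduct xs ys
concatMap≡cartesianProduct []       ys = refl
concatMap≡cartesianProduct (x ∷ xs) ys = cong (map (x ,_) ys ++_) (concatMap≡cartesianProduct xs ys)

-- A matching as a permutation: partners are swapped and unmatched vertices are fixed. Sums over the
-- vertices can then be reindexed along `q`.
record MatchingInvolution (G : Graph n) (q : Fin n → Fin n) : Set where
  field
    involutive : ∀ x → q (q x) ≡ x
    adjacent   : ∀ {x} → q x ≢ x → adj G x (q x) ≡ true

open MatchingInvolution

-- Adjacency at every vertex excludes fixed points because `adj` is irreflexive, so this is a
-- perfect matching.
record PerfectInvolution (G : Graph n) (q : Fin n → Fin n) : Set where
  field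
    p-involutive : ∀ x → q (q x) ≡ x
    p-adjacent   : ∀ x → adj G x (q x) ≡ true

open PerfectInvolution

-- Edges are stored with the smaller end first, so being partners in `M` has to allow both orders.
Joined : List (Edge n) → Fin n → Fin n → Set
Joined M x y = (x , y) ∈ M ⊎ (y , x) ∈ M

Joined-sym : {M : List (Edge n)} {x y : Fin n} → Joined M x y → Joined M y x
Joined-sym (inj₁ e) = inj₂ e
Joined-sym (inj₂ e) = inj₁ e

mate : List (Edge n) → Fin n → Fin n
mate []            w = w
mate ((u , v) ∷ M) w = if u == w then v else (if v == w then u else mate M w)

moved : (Fin n → Fin n) → Fin n → Bool
moved q x = not (q x == x)

module _ (G : Graph n) where

  adj⇒≢ : {x y : Fin n} → adj G x y ≡ true → x ≢ y
  adj⇒≢ {x} h refl = true≢false h (adj-irrefl G x)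

  adj-flip : {x y : Fin n} → adj G x y ≡ true → adj G y x ≡ true
  adj-flip {x} {y} h = trans (adj-sym G y x) h

  PerfectInvolution⇒MatchingInvolution : {q : Fin n → Fin n} → PerfectInvolution G q → MatchingInvolution G q
  PerfectInvolution⇒MatchingInvolution P = record
    { involutive = p-involutive P
    ; adjacent   = λ {x} _ → p-adjacent P x
    }

  isEdge⁻ : {u v : Fin n} → isEdge G (u , v) ≡ true → toℕ u < toℕ v × adj G u v ≡ true
  isEdge⁻ {u} {v} h = let a , b = ∧-true⁻ (toℕ u <ᵇ toℕ v) h in ℕₚ.<ᵇ⇒< _ _ (T⁺ a) , b

  isEdge⁺ : {u v : Fin n} → toℕ u < toℕ v → adj G u v ≡ true → isEdge G (u , v) ≡ true
  isEdge⁺ lt a = ∧-true⁺ (T⁻ (ℕₚ.<⇒<ᵇ lt)) a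

  orient : {u v : Fin n} → adj G u v ≡ true → isEdge G (u , v) ≡ true ⊎ isEdge G (v , u) ≡ true
  orient {u} {v} a with ℕₚ.<-cmp (toℕ u) (toℕ v)
  ... | tri< lt _ _ = inj₁ (isEdge⁺ lt a)
  ... | tri≈ _ eq _ = ⊥-elim (adj⇒≢ a (toℕ-injective eq))
  ... | tri> _ _ gt = inj₂ (isEdge⁺ gt (adj-flip a))

  covers⁻ : {u v w : Fin n} → covers G (u , v) w ≡ true → u ≡ w ⊎ v ≡ w
  covers⁻ {u} {v} {w} h with ∨-true⁻ (u == w) h
  ... | inj₁ e = inj₁ (==-true⁻ e)
  ... | inj₂ e = inj₂ (==-true⁻ e)

  covers-fst : (u v : Fin n) → covers G (u , v) u ≡ true
  covers-fst u v = ∨-true⁺ˡ _ (==-refl u)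

  covers-snd : (u v : Fin n) → covers G (u , v) v ≡ true
  covers-snd u v = ∨-true⁺ʳ (u == v) (==-refl v)

  ∈-edgeList⁺ : {e : Edge n} → isEdge G e ≡ true → e ∈ edgeList G
  ∈-edgeList⁺ {u , v} h = ∈-filter⁺ (λ e → T? (isEdge G e))
    (subst ((u , v) ∈_) (sym (concatMap≡cartesianProduct (allFin n) (allFin n)))
      (∈-cartesianProduct⁺ (∈-allFin u) (∈-allFin v))) (T⁺ h)

  ∈-edgeList⁻ : {e : Edge n} → e ∈ edgeList G → isEdge G e ≡ true
  ∈-edgeList⁻ e∈ = T⁻ (proj₂ (∈-filter⁻ (λ e → T? (isEdge G e)) 
    {xs = concatMap (λ u → map (u ,_) (allFin n)) (allFin n)} e∈))

  edgeList-unique : Unique (edgeList G)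
  edgeList-unique = Uniqueₚ.filter⁺ (λ e → T? (isEdge G e))
    (subst Unique (sym (concatMap≡cartesianProduct (allFin n) (allFin n)))
      (Uniqueₚ.cartesianProduct⁺ (Uniqueₚ.allFin⁺ n) (Uniqueₚ.allFin⁺ n)))

  edgesWhere : (Edge n → Bool) → List (Edge n)
  edgesWhere c = filter (λ e → T? (c e)) (edgeList G)

  ∈-edgesWhere⁺ : (c : Edge n → Bool) {e : Edge n} → isEdge G e ≡ true → c e ≡ true → e ∈ edgesWhere c
  ∈-edgesWhere⁺ c h ce = ∈-filter⁺ (λ e → T? (c e)) (∈-edgeList⁺ h) (T⁺ ce)

  ∈-edgesWhere⁻ : (c : Edge n → Bool) {e : Edge n} → e ∈ edgesWhere c → isEdge G e ≡ true × c e ≡ true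
  ∈-edgesWhere⁻ c e∈ = let a , b = ∈-filter⁻ (λ e → T? (c e)) {xs = edgeList G} e∈ in ∈-edgeList⁻ a , T⁻ b

  coverCount : List (Edge n) → Fin n → ℕ
  coverCount M w = length (filter (λ e → T? (covers G e w)) M)

  covered : List (Edge n) → Fin n → Bool
  covered M w = anyL (λ e → covers G e w) M

  Matching⁻ : (M : List (Edge n)) → Matching G M → (∀ {e} → e ∈ M → isEdge G e ≡ true) × (∀ w → coverCount M w ≤ 1)
  Matching⁻ M h = let a , b = ∧-true⁻ (allL (isEdge G) M) h in
    all-true⁻ (isEdge G) M a , λ w → ℕₚ.≤ᵇ⇒≤ _ _ (T⁺ (allV-true⁻ (λ w → coverCount M w ≤ᵇ 1) b w))

  Matching⁺ : {M : List (Edge n)} → (∀ {e} → e ∈ M → isEdge G e ≡ true) → (∀ w → coverCount M w ≤ 1) → Matching G M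
  Matching⁺ {M} a b = ∧-true⁺ (all-true⁺ (isEdge G) M a) (allV-true⁺ (λ w → coverCount M w ≤ᵇ 1) λ w → T⁻ (ℕₚ.≤⇒≤ᵇ (b w)))

  Matching-[] : Matching G []
  Matching-[] = Matching⁺ {[]} (λ ()) (λ _ → z≤n)

  ∈-covering⁺ : {M : List (Edge n)} {e : Edge n} (w : Fin n) →
    e ∈ M → covers G e w ≡ true → e ∈ filter (λ e → T? (covers G e w)) M
  ∈-covering⁺ w e∈ c = ∈-filter⁺ (λ e → T? (covers G e w)) e∈ (T⁺ c)

  ∈-covering⁻ : {M : List (Edge n)} {e : Edge n} (w : Fin n) →
    e ∈ filter (λ e → T? (covers G e w)) M → e ∈ M × covers G e w ≡ true
  ∈-covering⁻ {M} w e∈ = let a , b = ∈-filter⁻ (λ e → T? (covers G e w)) {xs = M} e∈ in a , T⁻ b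

  coverCount-∷ : ∀ e M w → coverCount (e ∷ M) w ≡ ⟦ covers G e w ⟧ + coverCount M w
  coverCount-∷ e M w with covers G e w
  ... | true  = refl
  ... | false = refl

  coverCount-uncovered : ∀ M w → covered M w ≡ false → coverCount M w ≡ 0
  coverCount-uncovered []      w h = refl
  coverCount-uncovered (e ∷ M) w h with covers G e w
  ... | false = coverCount-uncovered M w h

  count-covers : {e : Edge n} → isEdge G e ≡ true → count (covers G e) ≡ 2
  count-covers {u , v} h = trans (count-split {f = covers G (u , v)} {u ==_} {v ==_} disjoint)
    (cong₂ _+_ (count-singleton u) (count-singleton v))
    where
    disjoint : ∀ x → ⟦ (u == x) ∨ (v == x) ⟧ ≡ ⟦ u == x ⟧ + ⟦ v == x ⟧
    disjoint x with u ≟ x | v ≟ x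
    ... | yes refl | yes refl = ⊥-elim (adj⇒≢ (proj₂ (isEdge⁻ h)) refl)
    ... | yes _ | no _  = refl
    ... | no _  | yes _ = refl
    ... | no _  | no _  = refl

  -- Double counting of incidences: each edge has two distinct ends.
  sum-coverCount : ∀ M → (∀ {e} → e ∈ M → isEdge G e ≡ true) → sum (coverCount M) ≡ 2 * length M
  sum-coverCount []      h = sum-replicate-zero n
  sum-coverCount (e ∷ M) h = begin
    sum (coverCount (e ∷ M))                ≡⟨ sum-cong-≗ (coverCount-∷ e M) ⟩
    sum (λ w → ⟦ covers G e w ⟧ + coverCount M w) ≡⟨ ∑-distrib-+ (⟦_⟧ ∘ covers G e) (coverCount M) ⟩
    count (covers G e) + sum (coverCount M) ≡⟨ cong₂ _+_ (count-covers (h (here refl))) (sum-coverCount M (h ∘ there)) ⟩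
    2 + 2 * length M                        ≡⟨ ℕₚ.*-suc 2 (length M) ⟨
    2 * suc (length M)                      ∎
    where open ≡-Reasoning

  mate-joined : ∀ M w → covered M w ≡ true → Joined M w (mate M w)
  mate-joined ((u , v) ∷ M) w h with u ≟ w | v ≟ w
  ... | yes refl | _        = inj₁ (here refl)
  ... | no _     | yes refl = inj₂ (here refl)
  ... | no _     | no _     with mate-joined M w h
  ...   | inj₁ e = inj₁ (there e)
  ...   | inj₂ e = inj₂ (there e)

  mate-uncovered : ∀ M w → covered M w ≡ false → mate M w ≡ w
  mate-uncovered []            w h = refl
  mate-uncovered ((u , v) ∷ M) w h with u ≟ w | v ≟ w
  ... | no _ | no _ = mate-uncovered M w h

  Joined⇒covered : {M : List (Edge n)} {x y : Fin n} → Joined M x y → covered M x ≡ true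
  Joined⇒covered {M} {x} {y} (inj₁ e) = any-true⁺ _ M e (covers-fst x y)
  Joined⇒covered {M} {x} {y} (inj₂ e) = any-true⁺ _ M e (covers-snd y x)

  module _ (M : List (Edge n)) (match : Matching G M) where

    covering-unique : {e e′ : Edge n} (w : Fin n) → e ∈ M → e′ ∈ M → covers G e w ≡ true → covers G e′ w ≡ true → e ≡ e′
    covering-unique w e∈ e′∈ c c′ = length≤1⇒≡ (proj₂ (Matching⁻ M match) w) (∈-covering⁺ w e∈ c) (∈-covering⁺ w e′∈ c′)

    coverCount≡covered : ∀ w → coverCount M w ≡ ⟦ covered M w ⟧
    coverCount≡covered w with covered M w in eq
    ... | false = coverCount-uncovered M w eq
    ... | true  = let e , e∈ , c = any-true⁻ (λ e → covers G e w) M eq in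
      ≤-antisym (proj₂ (Matching⁻ M match) w) (∈-length (∈-covering⁺ w e∈ c))

    count-covered : count (covered M) ≡ 2 * length M
    count-covered = trans (sum-cong-≗ (sym ∘ coverCount≡covered)) (sum-coverCount M (proj₁ (Matching⁻ M match)))

    Joined⇒adj : {x y : Fin n} → Joined M x y → adj G x y ≡ true
    Joined⇒adj (inj₁ e) = proj₂ (isEdge⁻ (proj₁ (Matching⁻ M match) e))
    Joined⇒adj (inj₂ e) = adj-flip (proj₂ (isEdge⁻ (proj₁ (Matching⁻ M match) e)))

    Joined-functional : {x y z : Fin n} → Joined M x y → Joined M x z → y ≡ z
    Joined-functional {x} {y} {z} (inj₁ a) (inj₁ b) with covering-unique x a b (covers-fst x y) (covers-fst x z)
    ... | refl = refl
    Joined-functional {x} {y} {z} (inj₁ a) (inj₂ b) with covering-unique x a b (covers-fst x y) (covers-snd z x)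
    ... | refl = refl
    Joined-functional {x} {y} {z} (inj₂ a) (inj₁ b) with covering-unique x a b (covers-snd y x) (covers-fst x z)
    ... | refl = refl
    Joined-functional {x} {y} {z} (inj₂ a) (inj₂ b) with covering-unique x a b (covers-snd y x) (covers-snd z x)
    ... | refl = refl

    Joined⇒mate : {x y : Fin n} → Joined M x y → mate M x ≡ y
    Joined⇒mate {x} j = Joined-functional (mate-joined M x (Joined⇒covered j)) j

    mate-covered⇒adj : ∀ {x} → covered M x ≡ true → adj G x (mate M x) ≡ true
    mate-covered⇒adj {x} h = Joined⇒adj (mate-joined M x h)

    mate-involutive : ∀ x → mate M (mate M x) ≡ x
    mate-involutive x with bool-cases (covered M x)
    ... | inj₁ h = Joined⇒mate (Joined-sym (mate-joined M x h))
    ... | inj₂ h = trans (cong (mate M) (mate-uncovered M x h)) (mate-uncovered M x h)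

    mate-matching : MatchingInvolution G (mate M)
    mate-matching = record { involutive = mate-involutive ; adjacent = adj′ }
      where
      adj′ : ∀ {x} → mate M x ≢ x → adj G x (mate M x) ≡ true
      adj′ {x} ne with bool-cases (covered M x)
      ... | inj₁ h = mate-covered⇒adj h
      ... | inj₂ h = ⊥-elim (ne (mate-uncovered M x h))

    covered≡moved : ∀ x → covered M x ≡ moved (mate M) x
    covered≡moved x with bool-cases (covered M x)
    ... | inj₁ h = trans h (cong not (sym (==-false (adj⇒≢ (mate-covered⇒adj h) ∘ sym))))
    ... | inj₂ h = trans h (cong not (sym (==-true⁺ (mate-uncovered M x h))))

    count-moved-mate : count (moved (mate M)) ≡ 2 * length M
    count-moved-mate = trans (sym (count-cong covered≡moved)) count-covered

  mate-perfect : {M : List (Edge n)} → PerfectMatching G M → PerfectInvolution G (mate M)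
  mate-perfect {M} (match , cov) = record
    { p-involutive = mate-involutive M match
    ; p-adjacent   = λ x → mate-covered⇒adj M match (cov x)
    }

  module _ {q : Fin n → Fin n} (q-involutive : ∀ x → q (q x) ≡ x) where

    -- Two selected edges meeting at `w` both join `w` to `q w`, so they coincide. The selector `c`
    -- may pick only some edges of `q`, as `isCritical` does; `edgesOf` picks all of them.
    edgesWhere-matching : (c : Edge n → Bool) → (∀ {u v} → isEdge G (u , v) ≡ true → c (u , v) ≡ true → q u ≡ v) →
                          Matching G (edgesWhere c)
    edgesWhere-matching c c⊆q = Matching⁺ (proj₁ ∘ ∈-edgesWhere⁻ c) λ w →
      ≡⇒length≤1 (Uniqueₚ.filter⁺ (λ e → T? (covers G e w)) (Uniqueₚ.filter⁺ (λ e → T? (c e)) edgeList-unique))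
        λ e∈ e′∈ → let a , b = ∈-covering⁻ w e∈ ; a′ , b′ = ∈-covering⁻ w e′∈ in
          unique w (∈-edgesWhere⁻ c a) (∈-edgesWhere⁻ c a′) b b′
      where
      flip : ∀ {u v} → q u ≡ v → q v ≡ u
      flip {u} h = trans (cong q (sym h)) (q-involutive u)
      unique : ∀ w {e e′} → isEdge G e ≡ true × c e ≡ true → isEdge G e′ ≡ true × c e′ ≡ true →
               covers G e w ≡ true → covers G e′ w ≡ true → e ≡ e′
      unique w {u , v} {u′ , v′} (i , k) (i′ , k′) b b′ with covers⁻ {u} b | covers⁻ {u′} b′
      ... | inj₁ refl | inj₁ refl = cong (w ,_) (trans (sym (c⊆q i k)) (c⊆q i′ k′))
      ... | inj₂ refl | inj₂ refl = cong (_, w) (trans (sym (flip (c⊆q i k))) (flip (c⊆q i′ k′)))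
      -- The two edges would consist of the same two vertices in opposite orders, against the
      -- orientation of stored edges.
      ... | inj₁ refl | inj₂ refl with trans (sym (c⊆q i k)) (flip (c⊆q i′ k′))
      ...   | refl = ⊥-elim (ℕₚ.<-asym (proj₁ (isEdge⁻ i)) (proj₁ (isEdge⁻ i′)))
      unique w {u , v} {u′ , v′} (i , k) (i′ , k′) b b′ | inj₂ refl | inj₁ refl with trans (sym (flip (c⊆q i k))) (c⊆q i′ k′)
      ...   | refl = ⊥-elim (ℕₚ.<-asym (proj₁ (isEdge⁻ i)) (proj₁ (isEdge⁻ i′)))

  edgesOf : (Fin n → Fin n) → List (Edge n)
  edgesOf q = edgesWhere (λ (u , v) → q u == v)

  Joined-edgesOf : {q : Fin n → Fin n} → PerfectInvolution G q → ∀ x → Joined (edgesOf q) x (q x)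
  Joined-edgesOf {q} P x with orient (p-adjacent P x)
  ... | inj₁ h = inj₁ (∈-edgesWhere⁺ _ h (==-refl (q x)))
  ... | inj₂ h = inj₂ (∈-edgesWhere⁺ _ h (==-true⁺ (p-involutive P x)))

  edgesOf-perfect : {q : Fin n → Fin n} → PerfectInvolution G q → PerfectMatching G (edgesOf q)
  edgesOf-perfect P = edgesWhere-matching (p-involutive P) _ (λ _ → ==-true⁻) , λ w → Joined⇒covered (Joined-edgesOf P w)

  maxMatching-exists : ∃ λ M → Matching G M × length M ≡ μ G
  maxMatching-exists with maxList-attained length (filter (λ M → T? (isMatching G M)) (sublists G (edgeList G)))
  ... | inj₁ μ≡0           = [] , Matching-[] , sym μ≡0
  ... | inj₂ (M , M∈ , eq) = M , T⁻ (proj₂ (∈-filter⁻ (λ M → T? (isMatching G M)) {xs = sublists G (edgeList G)} M∈)) , eq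

-- α-critical edges

remove : (Fin n → Bool) → Fin n → Fin n → Bool
remove f u x = f x ∧ not (u == x)

remove⁻ : (f : Fin n → Bool) (u : Fin n) {x : Fin n} → remove f u x ≡ true → f x ≡ true × u ≢ x
remove⁻ f u {x} h = let a , b = ∧-true⁻ (f x) h in a , λ e → true≢false (==-true⁺ e) (not-true⁻ b)

remove⁺ : (f : Fin n → Bool) (u : Fin n) {x : Fin n} → f x ≡ true → u ≢ x → remove f u x ≡ true
remove⁺ f u a ne = ∧-true⁺ a (cong not (==-false ne))

remove-self : (f : Fin n → Bool) (u : Fin n) → remove f u u ≡ false
remove-self f u = ≢true⇒≡false λ h → proj₂ (remove⁻ f u h) refl

count-remove : (f : Fin n → Bool) (u : Fin n) → f u ≡ true → count f ≡ suc (count (remove f u))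
count-remove f u fu = trans (count-split {f = f} {u ==_} {remove f u} split)
  (cong (_+ count (remove f u)) (count-singleton u))
  where
  split : ∀ x → ⟦ f x ⟧ ≡ ⟦ u == x ⟧ + ⟦ remove f u x ⟧
  split x with u ≟ x
  ... | yes refl rewrite fu = refl
  ... | no _ with f x
  ...   | true  = refl
  ...   | false = refl

SameEdge : (u v x y : Fin n) → Set
SameEdge u v x y = (x ≡ u × y ≡ v) ⊎ (x ≡ v × y ≡ u)

sameEdge⁻ : {u v x y : Fin n} → sameEdge (u , v) x y ≡ true → SameEdge u v x y
sameEdge⁻ {u = u} {v} {x} {y} h with ∨-true⁻ ((x == u) ∧ (y == v)) h
... | inj₁ e = let a , b = ∧-true⁻ (x == u) e in inj₁ (==-true⁻ a , ==-true⁻ b)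
... | inj₂ e = let a , b = ∧-true⁻ (x == v) e in inj₂ (==-true⁻ a , ==-true⁻ b)

sameEdge⁺ : {u v x y : Fin n} → SameEdge u v x y → sameEdge (u , v) x y ≡ true
sameEdge⁺ {u = u} {v} (inj₁ (refl , refl)) = ∨-true⁺ˡ _ (∧-true⁺ (==-refl u) (==-refl v))
sameEdge⁺ {u = u} {v} (inj₂ (refl , refl)) = ∨-true⁺ʳ ((v == u) ∧ (u == v)) (∧-true⁺ (==-refl v) (==-refl u))

-- A certificate of criticality: deleting `uv` makes `set` stable, and it has more than `α G`
-- vertices.
record Critical (G : Graph n) (u v : Fin n) : Set where
  field
    edge    : adj G u v ≡ true
    set     : Fin n → Bool
    set-fst : set u ≡ true
    set-snd : set v ≡ true
    large   : α G < count set
    almost  : ∀ {x y} → set x ≡ true → set y ≡ true → adj G x y ≡ true → SameEdge u v x y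

open Critical

module _ (G : Graph n) where

  Critical-sym : {u v : Fin n} → Critical G u v → Critical G v u
  Critical-sym c = record
    { edge = adj-flip G (edge c) ; set = set c ; set-fst = set-snd c ; set-snd = set-fst c ; large = large c
    ; almost = λ a b d → Sum.swap (almost c a b d) }

  isCritical⁻ : {u v : Fin n} → adj G u v ≡ true → isCritical G (u , v) ≡ true → Critical G u v
  isCritical⁻ {u} {v} uv h with maxStable-exists (deleteEdge G (u , v))
  ... | f , st , le = record
    { edge = uv ; set = f ; set-fst = both proj₁ ; set-snd = both proj₂ ; large = lt ; almost = alm }
    where
    lt : α G < count f
    lt = ≤-trans (ℕₚ.<ᵇ⇒< _ _ (T⁺ h)) le
    alm : ∀ {x y} → f x ≡ true → f y ≡ true → adj G x y ≡ true → SameEdge u v x y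
    alm {x} {y} fx fy a with st x y fx fy
    ... | e rewrite a = sameEdge⁻ (not-false⁻ e)
    unstable : ¬ Stable G f
    unstable s = ℕₚ.<⇒≱ lt (Stable⇒count≤α G s)
    -- If `u` or `v` were missing, `f` would span no edge of `G` at all and would be a stable set
    -- with more than `α G` vertices.
    both : ∀ {w} → (f u ≡ true × f v ≡ true → f w ≡ true) → f w ≡ true
    both {w} k with bool-cases (f w)
    ... | inj₁ e = e
    ... | inj₂ e = ⊥-elim (unstable λ x y fx fy → ≢true⇒≡false λ a → true≢false (k (ends fx fy (alm fx fy a))) e)
      where
      ends : ∀ {x y} → f x ≡ true → f y ≡ true → SameEdge u v x y → f u ≡ true × f v ≡ true
      ends fx fy (inj₁ (refl , refl)) = fx , fy
      ends fx fy (inj₂ (refl , refl)) = fy , fx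

  isCritical⁺ : {u v : Fin n} → Critical G u v → isCritical G (u , v) ≡ true
  isCritical⁺ {u} {v} c = T⁻ (ℕₚ.<⇒<ᵇ (≤-trans (large c) (Stable⇒count≤α (deleteEdge G (u , v)) st)))
    where
    st : Stable (deleteEdge G (u , v)) (set c)
    st x y fx fy with adj G x y in eq
    ... | false = refl
    ... | true  = cong not (sameEdge⁺ (almost c fx fy eq))

  -- Losing `u` destroys the only edge inside the set and costs one vertex, which the strict
  -- inequality `large` can afford.
  Critical-remove : {u v : Fin n} (c : Critical G u v) → MaxStable G (remove (set c) u)
  Critical-remove {u} {v} c = st , s≤s⁻¹ (subst (α G <_) (count-remove (set c) u (set-fst c)) (large c))
    where
    st : Stable G (remove (set c) u)
    st x y fx fy with remove⁻ (set c) u fx | remove⁻ (set c) u fy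
    ... | a , nx | b , ny = ≢true⇒≡false λ e → case almost c a b e of λ where
      (inj₁ (p , _)) → nx (sym p)
      (inj₂ (_ , p)) → ny (sym p)

-- König–Egerváry graphs

-- Since count (moved q) is twice the number of matching edges, `maximum` says n ≤ α G + |matching|.
record KEInvolution (G : Graph n) (q : Fin n → Fin n) : Set where
  field
    matching : MatchingInvolution G q
    maximum  : 2 * n ≤ 2 * α G + count (moved q)

open KEInvolution

module _ (G : Graph n) {q : Fin n → Fin n} (ke : KEInvolution G q) where

  -- A stable set misses at least one end of each edge of `q`, so the indicator of `moved q` is at
  -- most `out x + out (q x)`. Summed, the right side is twice the size of the complement of `f`,
  -- which `maximum` bounds by `count (moved q)`. Hence equality holds at every vertex.
  outside⇒mate-inside : {f : Fin n → Bool} → MaxStable G f → {x : Fin n} → f x ≡ false →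
    f (q x) ≡ true × adj G x (q x) ≡ true
  outside⇒mate-inside {f} (st , α≤) {x} fx = final (sum-squeeze le total x)
    where
    out : Fin n → ℕ
    out x = ⟦ not (f x) ⟧
    le : ∀ x → ⟦ moved q x ⟧ ≤ out x + out (q x)
    le x with q x ≟ x
    ... | yes _ = z≤n
    ... | no ne with f x in e | f (q x) in e′
    ...   | false | _     = s≤s z≤n
    ...   | true  | false = s≤s z≤n
    ...   | true  | true  = ⊥-elim (true≢false (adjacent (matching ke) ne) (st x (q x) e e′))
    total : sum (λ x → out x + out (q x)) ≤ count (moved q)
    total = begin
      sum (λ x → out x + out (q x)) ≡⟨ ∑-distrib-+ out (out ∘ q) ⟩
      sum out + sum (out ∘ q)       ≡⟨ cong (sum out +_) (sum-involution q (involutive (matching ke)) out) ⟩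
      sum out + sum out             ≤⟨ +-cancelˡ-≤ (2 * count f) _ _ bound ⟩
      count (moved q)               ∎
      where
      open ℕₚ.≤-Reasoning
      double : ∀ a b → 2 * a + (b + b) ≡ 2 * (a + b)
      double = solve-∀
      bound : 2 * count f + (sum out + sum out) ≤ 2 * count f + count (moved q)
      bound = begin
        2 * count f + (sum out + sum out) ≡⟨ double (count f) (sum out) ⟩
        2 * (count f + sum out)           ≡⟨ cong (2 *_) (count-not f) ⟩
        2 * n                             ≤⟨ maximum ke ⟩
        2 * α G + count (moved q)         ≤⟨ +-monoˡ-≤ _ (ℕₚ.*-monoʳ-≤ 2 α≤) ⟩
        2 * count f + count (moved q)     ∎
    -- As `x` is outside `f`, the equality reads `⟦ moved q x ⟧ ≡ 1 + out (q x)`, which forces `x`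
    -- to be moved and `q x` to lie in `f`.
    final : ⟦ moved q x ⟧ ≡ out x + out (q x) → f (q x) ≡ true × adj G x (q x) ≡ true
    final h rewrite fx with q x ≟ x | f (q x) | h
    ... | yes _ | _     | ()
    ... | no ne | true  | _ = refl , adjacent (matching ke) ne
    ... | no ne | false | ()

  -- By `Critical-remove` the set without `u` is maximum stable, so it contains `q u`, a neighbour
  -- of `u`; the only edge inside the set is `uv`.
  Critical⇒mate : {u v : Fin n} → Critical G u v → q u ≡ v
  Critical⇒mate {u} {v} c with outside⇒mate-inside (Critical-remove G c) (remove-self (set c) u)
  ... | b , a with remove⁻ (set c) u b
  ...   | d , ne with almost c (set-fst c) d a
  ...     | inj₁ (_ , e) = e
  ...     | inj₂ (_ , e) = ⊥-elim (ne (sym e))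

  criticalEdges-matching : Matching G (criticalEdges G)
  criticalEdges-matching = edgesWhere-matching G (involutive (matching ke)) (isCritical G)
    λ i c → Critical⇒mate (isCritical⁻ G (proj₂ (isEdge⁻ G i)) c)

module _ (G : Graph n) where

  ∈-criticalEdges⁻ : {u v : Fin n} → (u , v) ∈ criticalEdges G → Critical G u v
  ∈-criticalEdges⁻ e∈ = let i , c = ∈-edgesWhere⁻ G (isCritical G) e∈ in isCritical⁻ G (proj₂ (isEdge⁻ G i)) c

  Joined⇒Critical : {x y : Fin n} → Joined (criticalEdges G) x y → Critical G x y
  Joined⇒Critical (inj₁ e) = ∈-criticalEdges⁻ e
  Joined⇒Critical (inj₂ e) = Critical-sym G (∈-criticalEdges⁻ e)

  Critical⇒Joined : {x y : Fin n} → Critical G x y → Joined (criticalEdges G) x y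
  Critical⇒Joined c with orient G (edge c)
  ... | inj₁ i = inj₁ (∈-edgesWhere⁺ G (isCritical G) i (isCritical⁺ G c))
  ... | inj₂ i = inj₂ (∈-edgesWhere⁺ G (isCritical G) i (isCritical⁺ G (Critical-sym G c)))

  criticallyCovered : Fin n → Bool
  criticallyCovered = covered G (criticalEdges G)

  criticallyCovered⁻ : {x : Fin n} → criticallyCovered x ≡ true → ∃ (Critical G x)
  criticallyCovered⁻ {x} h = mate (criticalEdges G) x , Joined⇒Critical (mate-joined G (criticalEdges G) x h)

  criticallyCovered⁺ : {x y : Fin n} → Critical G x y → criticallyCovered x ≡ true
  criticallyCovered⁺ c = Joined⇒covered G (Critical⇒Joined c)

  Critical-avoid : {u v : Fin n} → Critical G u v → ∃ λ f → MaxStable G f × f u ≡ false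
  Critical-avoid {u} c = _ , Critical-remove G c , remove-self (set c) u

  Critical-include : {u v : Fin n} → Critical G u v → ∃ λ f → MaxStable G f × f u ≡ true
  Critical-include {u} {v} c = _ , Critical-remove G (Critical-sym G c) ,
    remove⁺ (set c) v (set-fst c) (adj⇒≢ G (edge c) ∘ sym)

-- Alternating cycles

transpose-fst : (i j : Fin n) → transpose i j i ≡ j
transpose-fst i j rewrite dec-true (i ≟ i) refl = refl

transpose-snd : (i j : Fin n) → transpose i j j ≡ i
transpose-snd i j with j ≟ i
... | yes refl = refl
... | no _ rewrite dec-true (j ≟ j) refl = refl

transpose-other : (i j : Fin n) {k : Fin n} → k ≢ i → k ≢ j → transpose i j k ≡ k
transpose-other i j {k} k≢i k≢j rewrite dec-false (k ≟ i) k≢i | dec-false (k ≟ j) k≢j = refl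

-- When `p` is a perfect matching, `flips` says that `S` contains exactly one end of each of its
-- edges.
record Transversal (H : Graph n) (p : Fin n → Fin n) (S : Fin n → Bool) : Set where
  field
    stable : Stable H S
    flips  : ∀ x → S (p x) ≡ not (S x)

open Transversal

count-flips : {p : Fin n → Fin n} → (∀ x → p (p x) ≡ x) → (S : Fin n → Bool) →
  (∀ x → S (p x) ≡ not (S x)) → count S + count S ≡ n
count-flips {p = p} p-inv S fl = begin
  count S + count S         ≡⟨ cong (count S +_) (sum-involution p p-inv (⟦_⟧ ∘ S)) ⟨
  count S + count (S ∘ p)   ≡⟨ cong (count S +_) (count-cong fl) ⟩
  count S + count (not ∘ S) ≡⟨ count-not S ⟩
  _                         ∎
  where open ≡-Reasoning

module _ (H : Graph n) {p : Fin n → Fin n} (P : PerfectInvolution H p)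
         (p-unique : ∀ {r} → PerfectInvolution H r → ∀ x → r x ≡ p x)
         (2α≤n : α H + α H ≤ n)
         {S S′ : Fin n → Bool} (S-tr : Transversal H p S) (S′-tr : Transversal H p S′)
         {u : Fin n} (u∈S : S u ≡ true) (pu∈S′ : S′ (p u) ≡ true) where

  private
    mate∉S : ∀ {x} → S x ≡ true → S (p x) ≡ false
    mate∉S {x} h = trans (flips S-tr x) (cong not h)

    separate : ∀ {x y} → S x ≡ true → S y ≡ false → x ≢ y
    separate a b refl = true≢false a b

  -- g is a matching missing exactly u and p w; it pairs these two by convention so as to stay an involution.
  record Exposing (W : Fin n → Bool) (w : Fin n) : Set where
    field
      g          : Fin n → Fin n
      g-inv      : ∀ x → g (g x) ≡ x
      g-exposed  : g u ≡ p w
      g-adjacent : ∀ {x} → x ≢ u → x ≢ p w → adj H x (g x) ≡ true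
      g-agrees   : ∀ {x} → S x ≡ true → W x ≡ false → g x ≡ p x

  open Exposing

  -- An intermediate stage in building the least set `W`. `pW⊆S′` keeps `p(W)` stable, and
  -- `exposing` stores, for each `w`, the result of switching `p` along an alternating path from `u`
  -- to `p w`.
  record Ancestors (W : Fin n → Bool) : Set where
    field
      W-root    : W u ≡ true
      W⊆S       : ∀ {w} → W w ≡ true → S w ≡ true
      pW⊆S′     : ∀ {w} → W w ≡ true → S′ (p w) ≡ true
      exposing  : ∀ {w} → W w ≡ true → Exposing W w

  open Ancestors

  root : Ancestors (u ==_)
  root = record
    { W-root   = ==-refl u
    ; W⊆S      = λ h → subst (λ w → S w ≡ true) (==-true⁻ h) u∈S
    ; pW⊆S′    = λ h → subst (λ w → S′ (p w) ≡ true) (==-true⁻ h) pu∈S′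
    -- For `w` equal to `u` nothing has been switched: pairing `u` with `p u` is read as missing
    -- both.
    ; exposing = λ h → subst (Exposing (u ==_)) (==-true⁻ h) (record
        { g = p ; g-inv = p-involutive P ; g-exposed = refl
        ; g-adjacent = λ {x} _ _ → p-adjacent P x ; g-agrees = λ _ _ → refl })
    }

  module _ {W : Fin n → Bool} (anc : Ancestors W) {w s : Fin n}
           (w∈W : W w ≡ true) (s∈S : S s ≡ true) (s∉W : W s ≡ false) (sw : adj H s (p w) ≡ true) where

    insert : Fin n → Bool
    insert x = W x ∨ (s == x)

    insert-false⁻ : ∀ {x} → insert x ≡ false → W x ≡ false × s ≢ x
    insert-false⁻ {x} h = ≢true⇒≡false (λ a → true≢false (∨-true⁺ˡ _ a) h) ,
                          λ e → true≢false (∨-true⁺ʳ (W x) (==-true⁺ e)) h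

    -- Being outside `W`, `s` is still matched to `p s`. Replacing that edge by the one from `s` to
    -- `p w` exposes `u` and `p s` instead. Conjugating `g` by the transposition of `u` and `s` does
    -- this: `s` inherits the conventional partner `p w` of `u`, and `u` inherits `p s`.
    switch : Exposing W w → Exposing insert s
    switch E = record
      { g = g′ ; g-inv = g′-inv ; g-exposed = g′-exposed ; g-adjacent = g′-adjacent _ ; g-agrees = g′-agrees }
      where
      τ τ⁻¹ g′ : Fin n → Fin n
      τ   = transpose u s
      τ⁻¹ = transpose s u
      g′ x = τ (g E (τ⁻¹ x))
      pw∉S = mate∉S (W⊆S anc w∈W)
      ps∉S = mate∉S s∈S
      τ-fix : ∀ {x} → x ≢ u → x ≢ s → τ x ≡ x
      τ-fix = transpose-other u s
      τ⁻¹-fix : ∀ {x} → x ≢ u → x ≢ s → τ⁻¹ x ≡ x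
      τ⁻¹-fix a b = transpose-other s u b a
      τ-fix-∉S : ∀ {x} → S x ≡ false → τ x ≡ x
      τ-fix-∉S h = τ-fix (separate u∈S h ∘ sym) (separate s∈S h ∘ sym)
      gs : g E s ≡ p s
      gs = g-agrees E s∈S s∉W
      g′-inv : ∀ x → g′ (g′ x) ≡ x
      g′-inv x = begin
        τ (g E (τ⁻¹ (τ (g E (τ⁻¹ x))))) ≡⟨ cong (τ ∘ g E) (transpose-inverse s u) ⟩
        τ (g E (g E (τ⁻¹ x)))           ≡⟨ cong τ (g-inv E _) ⟩
        τ (τ⁻¹ x)                       ≡⟨ transpose-inverse u s ⟩
        x                               ∎
        where open ≡-Reasoning
      g′-exposed : g′ u ≡ p s
      g′-exposed = trans (cong (τ ∘ g E) (transpose-snd s u)) (trans (cong τ gs) (τ-fix-∉S ps∉S))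
      g′s : g′ s ≡ p w
      g′s = trans (cong (τ ∘ g E) (transpose-fst s u)) (trans (cong τ (g-exposed E)) (τ-fix-∉S pw∉S))
      g′-adjacent : ∀ x → x ≢ u → x ≢ p s → adj H x (g′ x) ≡ true
      g′-adjacent x x≢u x≢ps = cases (x ≟ s) (x ≟ p w)
        where
        cases : Dec (x ≡ s) → Dec (x ≡ p w) → adj H x (g′ x) ≡ true
        -- The one new matching edge joins `s` and `p w` and is supplied by `sw`; any other vertex
        -- considered here keeps its partner under `g`.
        cases (yes refl) _          = trans (cong (adj H s) g′s) sw
        cases (no _)     (yes refl) = trans (cong (adj H x) (trans (cong g′ (sym g′s)) (g′-inv s))) (adj-flip H sw)
        cases (no x≢s)   (no x≢pw)  =
          trans (cong (adj H x) (trans (cong (τ ∘ g E) (τ⁻¹-fix x≢u x≢s)) (τ-fix gx≢u gx≢s))) (g-adjacent E x≢u x≢pw)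
          where
          gx≢u : g E x ≢ u
          gx≢u e = x≢pw (trans (sym (g-inv E x)) (trans (cong (g E) e) (g-exposed E)))
          gx≢s : g E x ≢ s
          gx≢s e = x≢ps (trans (sym (g-inv E x)) (trans (cong (g E) e) gs))
      g′-agrees : ∀ {x} → S x ≡ true → insert x ≡ false → g′ x ≡ p x
      g′-agrees {x} x∈S h = let x∉W , s≢x = insert-false⁻ h in
        trans (cong (τ ∘ g E) (τ⁻¹-fix (λ { refl → true≢false (W-root anc) x∉W }) (s≢x ∘ sym)))
              (trans (cong τ (g-agrees E x∈S x∉W)) (τ-fix-∉S (mate∉S x∈S)))

    weaken : ∀ {x} → Exposing W x → Exposing insert x
    weaken E = record
      { g = g E ; g-inv = g-inv E ; g-exposed = g-exposed E ; g-adjacent = g-adjacent E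
      ; g-agrees = λ a b → g-agrees E a (proj₁ (insert-false⁻ b)) }

    insert-elim : (Q : Fin n → Set) → (∀ {x} → W x ≡ true → Q x) → Q s → ∀ {x} → insert x ≡ true → Q x
    insert-elim Q a b {x} h with ∨-true⁻ (W x) h
    ... | inj₁ e = a e
    ... | inj₂ e = subst Q (==-true⁻ e) b

    insert-ancestors : Ancestors insert
    insert-ancestors = record
      { W-root   = ∨-true⁺ˡ _ (W-root anc)
      ; W⊆S      = insert-elim (λ x → S x ≡ true) (W⊆S anc) s∈S
      ; pW⊆S′    = insert-elim (λ x → S′ (p x) ≡ true) (pW⊆S′ anc) (trans (flips S′-tr s) (cong not s∉S′))
      ; exposing = insert-elim (Exposing insert) (weaken ∘ exposing anc) (switch (exposing anc w∈W))
      }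
      where
      -- The neighbour `p w` of `s` lies in the stable set `S′`, so `s` does not, and therefore
      -- `p s` does.
      s∉S′ : S′ s ≡ false
      s∉S′ = ≢true⇒≡false λ s∈S′ → true≢false sw (stable S′-tr s (p w) s∈S′ (pW⊆S′ anc w∈W))

    count-insert : suc (count W) ≤ count insert
    count-insert = subst (suc (count W) ≤_) (sym (count-remove insert s (∨-true⁺ʳ (W s) (==-refl s))))
      (s≤s (count-mono {f = W} {g = remove insert s} λ x x∈W →
        remove⁺ insert s (∨-true⁺ˡ _ x∈W) λ { refl → true≢false x∈W s∉W }))

  module _ {W : Fin n → Bool} (anc : Ancestors W)
           (closed : ∀ {w s} → W w ≡ true → S s ≡ true → W s ≡ false → adj H s (p w) ≡ false) where

    private
      -- `S` with `W` exchanged for `p(W)`: as `p` is an involution, `W (p x)` says that `x` lies in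
      -- `p(W)`.
      flipped : Fin n → Bool
      flipped x = (S x ∧ not (W x)) ∨ W (p x)

      W-false : ∀ {x} → S x ≡ false → W x ≡ false
      W-false h = ≢true⇒≡false λ a → true≢false (W⊆S anc a) h

      -- The exchange takes place along whole edges of `p`, so exactly one end of each is still
      -- selected.
      flipped-flips : ∀ x → flipped (p x) ≡ not (flipped x)
      flipped-flips x rewrite p-involutive P x | flips S-tr x with S x in e
      ... | true  rewrite W-false (mate∉S e) with W x
      ...   | true  = refl
      ...   | false = refl
      flipped-flips x | false rewrite W-false e with W (p x)
      ...   | true  = refl
      ...   | false = refl

      u∉flipped : flipped u ≡ false
      u∉flipped = cong₂ _∨_ (cong₂ (λ a b → a ∧ not b) u∈S (W-root anc)) (W-false (mate∉S u∈S))

      witness : Fin n → Bool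
      witness x = flipped x ∨ (u == x)

      data Part (x : Fin n) : Set where
        unflipped : S x ≡ true → W x ≡ false → Part x
        switched  : W (p x) ≡ true → Part x
        extra     : u ≡ x → Part x

      part : ∀ {x} → witness x ≡ true → Part x
      part {x} h with ∨-true⁻ (flipped x) h
      ... | inj₂ e = extra (==-true⁻ e)
      ... | inj₁ e with ∨-true⁻ (S x ∧ not (W x)) e
      ...   | inj₂ b = switched b
      ...   | inj₁ b = let c , d = ∧-true⁻ (S x) b in unflipped c (not-true⁻ d)

      switched∈S′ : ∀ {x} → W (p x) ≡ true → S′ x ≡ true
      switched∈S′ {x} h = subst (λ y → S′ y ≡ true) (p-involutive P x) (pW⊆S′ anc h)

      nonadjacent : ∀ {x y} → S x ≡ true → W x ≡ false → W (p y) ≡ true → adj H x y ≡ false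
      nonadjacent {x} {y} a b c = subst (λ z → adj H x z ≡ false) (p-involutive P y) (closed c a b)

      -- The edge uy turns the involution exposing u and y into a perfect matching, which is p by uniqueness.
      collapse : ∀ {y} → W (p y) ≡ true → adj H u y ≡ true → y ≡ p u
      collapse {y} h uy = trans (sym gu) (p-unique perfect u)
        where
        E = exposing anc h
        gu : g E u ≡ y
        gu = trans (g-exposed E) (p-involutive P y)
        perfect : PerfectInvolution H (g E)
        perfect = record { p-involutive = g-inv E ; p-adjacent = adj′ }
          where
          adj′ : ∀ x → adj H x (g E x) ≡ true
          adj′ x with x ≟ u | x ≟ y
          ... | yes refl | _        = trans (cong (adj H u) gu) uy
          ... | no _     | yes refl = trans (cong (adj H x) (trans (cong (g E) (sym gu)) (g-inv E u))) (adj-flip H uy)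
          ... | no a     | no b     = g-adjacent E a (b ∘ λ e → trans e (p-involutive P y))

      absurd : ∀ {b} {Q : Set} → b ≡ false → b ≡ true → Q
      absurd f t = ⊥-elim (true≢false t f)

      -- No edge lies within `S` or within `S′`, and `closed` excludes edges between the unflipped
      -- part and `p(W)`. What remains joins `u` to `p(W)`, and `collapse` identifies it as the edge
      -- to `p u`.
      almost′ : ∀ {x y} → Part x → Part y → adj H x y ≡ true → SameEdge u (p u) x y
      almost′ (unflipped a _) (unflipped b _) e = absurd (stable S-tr _ _ a b) e
      almost′ (unflipped a b) (switched c)    e = absurd (nonadjacent a b c) e
      almost′ (unflipped a _) (extra refl)    e = absurd (stable S-tr _ _ a u∈S) e
      almost′ (switched c)    (unflipped a b) e = absurd (nonadjacent a b c) (adj-flip H e)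
      almost′ (switched a)    (switched b)    e = absurd (stable S′-tr _ _ (switched∈S′ a) (switched∈S′ b)) e
      almost′ (switched a)    (extra refl)    e = inj₂ (collapse a (adj-flip H e) , refl)
      almost′ (extra refl)    (unflipped a _) e = absurd (stable S-tr _ _ u∈S a) e
      almost′ (extra refl)    (switched b)    e = inj₁ (refl , collapse b e)
      almost′ (extra refl)    (extra refl)    e = absurd (adj-irrefl H u) e

      u∈witness : witness u ≡ true
      u∈witness = ∨-true⁺ʳ (flipped u) (==-refl u)

      pu∈witness : witness (p u) ≡ true
      pu∈witness = ∨-true⁺ˡ _ (trans (flipped-flips u) (cong not u∉flipped))

      -- By `flipped-flips` exactly half of the vertices lie in `flipped`, while `2α≤n` makes `α H`
      -- at most half.
      α≤flipped : α H ≤ count flipped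
      α≤flipped = ℕₚ.≮⇒≥ λ lt → ℕₚ.<⇒≱ (ℕₚ.+-mono-< lt lt)
        (subst (α H + α H ≤_) (sym (count-flips (p-involutive P) flipped flipped-flips)) 2α≤n)

      flipped≤ : count flipped ≤ count (remove witness u)
      flipped≤ = count-mono {f = flipped} {g = remove witness u} λ x h →
        remove⁺ witness u (∨-true⁺ˡ _ h) λ { refl → true≢false h u∉flipped }

    closed⇒Critical : Critical H u (p u)
    closed⇒Critical = record
      { edge    = p-adjacent P u
      ; set     = witness
      ; set-fst = u∈witness
      ; set-snd = pu∈witness
      ; large   = subst (α H <_) (sym (count-remove witness u u∈witness)) (s≤s (≤-trans α≤flipped flipped≤))
      ; almost  = λ a b → almost′ (part a) (part b)
      }

  -- The hypothesis makes `k` a bound on the number of vertices outside `W`. Either `W` is closed,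
  -- or a vertex `s` violating closedness is inserted and `k` drops by one.
  grow : ∀ k {W} → Ancestors W → n ≤ count W + k → Critical H u (p u)
  grow k {W} anc le with any? (λ w → any? (λ s → (W w ∧ (S s ∧ (not (W s) ∧ adj H s (p w)))) Bool.≟ true))
  ... | no none = closed⇒Critical anc λ {w} {s} a b c → ≢true⇒≡false λ d →
          none (w , s , ∧-true⁺ a (∧-true⁺ b (∧-true⁺ (cong not c) d)))
  grow k {W} anc le | yes (w , s , h) with ∧-true⁻ (W w) h
  ...   | w∈W , h₁ with ∧-true⁻ (S s) h₁
  ...     | s∈S , h₂ with ∧-true⁻ (not (W s)) h₂
  ...       | s∉W , sw = continue k le
    where
    W⁺ = insert anc w∈W s∈S (not-true⁻ s∉W) sw
    grew : suc (count W) ≤ count W⁺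
    grew = count-insert anc w∈W s∈S (not-true⁻ s∉W) sw
    W⁺≤n : count W⁺ ≤ n
    W⁺≤n = subst (count W⁺ ≤_) (count-true n) (count-mono {f = W⁺} {g = λ _ → true} (λ _ _ → refl))
    continue : ∀ k → n ≤ count W + k → Critical H u (p u)
    -- With no fuel left `W` would already have `n` vertices, leaving no room for the larger `W⁺`.
    continue zero    le = ⊥-elim (ℕₚ.<⇒≱ (≤-trans grew W⁺≤n) (subst (n ≤_) (ℕₚ.+-identityʳ _) le))
    continue (suc k) le = grow k (insert-ancestors anc w∈W s∈S (not-true⁻ s∉W) sw)
      (≤-trans (subst (n ≤_) (ℕₚ.+-suc _ k) le) (+-monoˡ-≤ k grew))

  unique⇒Critical : Critical H u (p u)
  unique⇒Critical = grow n root (ℕₚ.m≤n+m n _)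

-- Induced subgraphs

count-lookup : (g : A → Bool) (xs : List A) → count (g ∘ lookup xs) ≡ length (filter (λ x → T? (g x)) xs)
count-lookup g []       = refl
count-lookup g (x ∷ xs) with g x
... | true  = cong suc (count-lookup g xs)
... | false = count-lookup g xs

length-filter-∧ : (k g : A → Bool) (xs : List A) →
                  length (filter (λ x → T? (g x)) (filter (λ x → T? (k x)) xs)) ≡ length (filter (λ x → T? (k x ∧ g x)) xs)
length-filter-∧ k g []       = refl
length-filter-∧ k g (x ∷ xs) with k x
... | false = length-filter-∧ k g xs
... | true  with g x
...   | true  = cong suc (length-filter-∧ k g xs)
...   | false = length-filter-∧ k g xs

lookup-injective : {xs : List A} → Unique xs → ∀ i j → lookup xs i ≡ lookup xs j → i ≡ j
lookup-injective (_ ∷ _)   zero    zero    e = refl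
lookup-injective (x∉ ∷ _)  zero    (suc j) e = ⊥-elim (All.lookup x∉ (∈-lookup j) e)
lookup-injective (x∉ ∷ _)  (suc i) zero    e = ⊥-elim (All.lookup x∉ (∈-lookup i) (sym e))
lookup-injective (_ ∷ uxs) (suc i) (suc j) e = cong suc (lookup-injective uxs i j e)

module Induced (G : Graph n) (k : Fin n → Bool) where

  m : ℕ
  m = length (keptVertices G k)

  ι : Fin m → Fin n
  ι = lookup (keptVertices G k)

  ι-injective : ∀ {i j} → ι i ≡ ι j → i ≡ j
  ι-injective {i} {j} = lookup-injective (Uniqueₚ.filter⁺ (λ v → T? (k v)) (Uniqueₚ.allFin⁺ n)) i j

  ι-kept : ∀ i → k (ι i) ≡ true
  ι-kept i = T⁻ (proj₂ (∈-filter⁻ (λ v → T? (k v)) {xs = allFin n} (∈-lookup {xs = keptVertices G k} i)))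

  ι-surjective : ∀ {x} → k x ≡ true → ∃ λ i → ι i ≡ x
  ι-surjective {x} h = let x∈ = ∈-filter⁺ (λ v → T? (k v)) (∈-allFin x) (T⁺ h) in index x∈ , sym (lookup-index x∈)

  count-ι : (g : Fin n → Bool) → count (g ∘ ι) ≡ count (λ x → k x ∧ g x)
  count-ι g = trans (count-lookup g (keptVertices G k))
    (trans (length-filter-∧ k g (allFin n)) (length-filter (λ x → k x ∧ g x) (λ x → x)))

  count-within : {g : Fin n → Bool} → (∀ {x} → g x ≡ true → k x ≡ true) → count g ≡ count (g ∘ ι)
  count-within {g} sub = trans
    (count-cong {f = g} {g = λ x → k x ∧ g x} λ x → bool-ext (λ h → ∧-true⁺ (sub h) h) (proj₂ ∘ ∧-true⁻ (k x)))
    (sym (count-ι g))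

  lift : (Fin m → Bool) → Fin n → Bool
  lift g x = anyV (λ i → (ι i == x) ∧ g i)

  lift⁻ : (g : Fin m → Bool) {x : Fin n} → lift g x ≡ true → ∃ λ i → ι i ≡ x × g i ≡ true
  lift⁻ g {x} h = let i , e = anyV-true⁻ (λ i → (ι i == x) ∧ g i) h ; a , b = ∧-true⁻ (ι i == x) e in i , ==-true⁻ a , b

  lift⁺ : (g : Fin m → Bool) (i : Fin m) → g i ≡ true → lift g (ι i) ≡ true
  lift⁺ g i h = anyV-true⁺ (λ j → (ι j == ι i) ∧ g j) i (∧-true⁺ (==-refl (ι i)) h)

  lift-ι : (g : Fin m → Bool) (i : Fin m) → lift g (ι i) ≡ g i
  lift-ι g i = bool-ext (λ h → let j , e , gj = lift⁻ g h in subst (λ j → g j ≡ true) (ι-injective e) gj) (lift⁺ g i)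

  lift-kept : (g : Fin m → Bool) {x : Fin n} → lift g x ≡ true → k x ≡ true
  lift-kept g h = let i , e , _ = lift⁻ g h in subst (λ x → k x ≡ true) e (ι-kept i)

  count-lift : (g : Fin m → Bool) → count (lift g) ≡ count g
  count-lift g = trans (count-within {lift g} (lift-kept g)) (count-cong {f = lift g ∘ ι} {g = g} (lift-ι g))

-- Perfect matchings when 2α = n

Matching-∷ : (G : Graph n) {e : Edge n} (M : List (Edge n)) → isEdge G e ≡ true → Matching G M →
             (∀ w → covers G e w ≡ true → covered G M w ≡ false) → Matching G (e ∷ M)
Matching-∷ G {e} M ie match free = Matching⁺ G {e ∷ M} edges λ w → subst (_≤ 1) (sym (coverCount-∷ G e M w)) (once w)
  where
  edges : ∀ {d} → d ∈ e ∷ M → isEdge G d ≡ true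
  edges (here refl) = ie
  edges (there d∈)  = proj₁ (Matching⁻ G M match) d∈
  once : ∀ w → ⟦ covers G e w ⟧ + coverCount G M w ≤ 1
  once w with bool-cases (covers G e w)
  ... | inj₁ c rewrite c | coverCount-uncovered G M w (free w c) = ≤-refl
  ... | inj₂ c rewrite c = proj₂ (Matching⁻ G M match) w

module _ (H : Graph n) (2α≡n : α H + α H ≡ n) where

  -- All `n` vertices are moved, so `maximum` holds with equality: 2n = 2α + n.
  PerfectInvolution⇒KEInvolution : {r : Fin n → Fin n} → PerfectInvolution H r → KEInvolution H r
  PerfectInvolution⇒KEInvolution {r} R = record
    { matching = PerfectInvolution⇒MatchingInvolution H R
    ; maximum  = ≤-reflexive (sym (cong₂ _+_ 2α≡n′ (trans all-moved (sym (ℕₚ.+-identityʳ n)))))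
    }
    where
    2α≡n′ : 2 * α H ≡ n
    2α≡n′ = trans (cong (α H +_) (ℕₚ.+-identityʳ (α H))) 2α≡n
    all-moved : count (moved r) ≡ n
    all-moved = trans
      (count-cong {f = moved r} {g = λ _ → true} λ x → cong not (==-false (adj⇒≢ H (p-adjacent R x) ∘ sym)))
      (count-true n)

  -- Stability prevents `S` from containing both ends of an edge of `r`, and `outside⇒mate-inside`
  -- prevents it from missing both.
  MaxStable⇒Transversal : {r : Fin n → Fin n} → PerfectInvolution H r →
    {S : Fin n → Bool} → MaxStable H S → Transversal H r S
  MaxStable⇒Transversal {r} R {S} ms@(st , _) = record { stable = st ; flips = fl }
    where
    fl : ∀ x → S (r x) ≡ not (S x)
    fl x with S x in e
    ... | true  = ≢true⇒≡false λ h → true≢false (p-adjacent R x) (st x (r x) e h)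
    ... | false = proj₁ (outside⇒mate-inside H (PerfectInvolution⇒KEInvolution R) ms e)

  module _ (PM : ∃ (PerfectInvolution H))
           (in-some  : ∀ x → ∃ λ S → MaxStable H S × S x ≡ true)
           (out-some : ∀ x → ∃ λ S → MaxStable H S × S x ≡ false) where

    private
      C : List (Edge n)
      C = criticalEdges H

      AllCovered : Set
      AllCovered = ∀ x → criticallyCovered H x ≡ true

      p : Fin n → Fin n
      p = proj₁ PM

      ke : KEInvolution H p
      ke = PerfectInvolution⇒KEInvolution (proj₂ PM)

      C-matching : Matching H C
      C-matching = criticalEdges-matching H ke

    -- A maximum stable set avoiding `x` contains the mate of `x`, so `in-some` and `out-some`
    -- supply the `S` and `S′` that `unique⇒Critical` needs.
    unique⇒covered : UniquePerfectMatching H → AllCovered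
    unique⇒covered (M , pm , uniq) x =
      let S  , ms  , x∈S  = in-some x
          S′ , ms′ , x∉S′ = out-some x
          tr′ = MaxStable⇒Transversal Q ms′
      in criticallyCovered⁺ H (unique⇒Critical H Q mate-unique (≤-reflexive 2α≡n)
           (MaxStable⇒Transversal Q ms) tr′ x∈S (trans (Transversal.flips tr′ x) (cong not x∉S′)))
      where
      Q : PerfectInvolution H (mate M)
      Q = mate-perfect H {M} pm
      transfer : ∀ {M′ x y} → PerfectMatching H M′ → Joined M′ x y → Joined M x y
      transfer pm′ = Sum.map (Equivalence.to (uniq _ pm′ _)) (Equivalence.to (uniq _ pm′ _))
      -- Uniqueness is stated for edge lists, so an involution `r` is compared with `M` through the
      -- list `edgesOf r`.
      mate-unique : ∀ {r} → PerfectInvolution H r → ∀ x → r x ≡ mate M x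
      mate-unique R x = sym (Joined⇒mate H M (proj₁ pm) (transfer (edgesOf-perfect H R) (Joined-edgesOf H R x)))

    -- `Critical⇒mate` puts every critical edge into every perfect matching; once the critical edges
    -- cover all vertices, no other edge fits.
    covered⇒unique : AllCovered → UniquePerfectMatching H
    covered⇒unique cov = C , (C-matching , cov) , λ M pm e → mk⇔ (to M pm e) (from M pm e)
      where
      module _ (M : List (Edge n)) (pm : PerfectMatching H M) where
        Critical⇒mateM : ∀ {u v} → Critical H u v → mate M u ≡ v
        Critical⇒mateM = Critical⇒mate H (PerfectInvolution⇒KEInvolution (mate-perfect H {M} pm))
        to : ∀ e → e ∈ M → e ∈ C
        to (u , v) e∈ = let w , c = criticallyCovered⁻ H (cov u)
                            e : v ≡ w
                            e = trans (sym (Joined⇒mate H M (proj₁ pm) (inj₁ e∈))) (Critical⇒mateM c)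
                        in ∈-edgesWhere⁺ H (isCritical H) (proj₁ (Matching⁻ H M (proj₁ pm)) e∈)
                             (isCritical⁺ H (subst (Critical H u) (sym e) c))
        from : ∀ e → e ∈ C → e ∈ M
        from (u , v) e∈ = oriented
          (subst (Joined M u) (Critical⇒mateM (∈-criticalEdges⁻ H e∈)) (mate-joined H M u (proj₂ pm u)))
          where
          oriented : Joined M u v → (u , v) ∈ M
          oriented (inj₁ uv∈) = uv∈
          oriented (inj₂ vu∈) = ⊥-elim (ℕₚ.<-asym (proj₁ (isEdge⁻ H (proj₁ (Matching⁻ H C C-matching) e∈)))
                                                 (proj₁ (isEdge⁻ H (proj₁ (Matching⁻ H M (proj₁ pm)) vu∈))))

    covered⇒maximal : AllCovered → MaximalMatching H C
    covered⇒maximal cov = C-matching , λ (u , v) _ e∉ match →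
      let d , d∈ , c = any-true⁻ (λ e → covers H e u) C (cov u)
          e≡d = covering-unique H ((u , v) ∷ C) match u (here refl) (there d∈) (covers-fst H u v) c
      in e∉ (subst (_∈ C) (sym e≡d) d∈)

    -- If `x` is uncovered, so is `p x`: a critical edge at `p x` belongs to `p` and hence ends in
    -- `x`. The edge between `x` and `p x` could then be added.
    maximal⇒covered : MaximalMatching H C → AllCovered
    maximal⇒covered (_ , maximal) x with bool-cases (criticallyCovered H x)
    ... | inj₁ h = h
    ... | inj₂ x∉ = ⊥-elim (add (orient H (p-adjacent (proj₂ PM) x)))
      where
      px∉ : criticallyCovered H (p x) ≡ false
      px∉ = ≢true⇒≡false λ h → let y , c = criticallyCovered⁻ H h
                                   e : x ≡ y
                                   e = trans (sym (p-involutive (proj₂ PM) x)) (Critical⇒mate H ke c)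
                               in true≢false (criticallyCovered⁺ H (Critical-sym H (subst (Critical H (p x)) (sym e) c))) x∉
      extend : ∀ {u v} → criticallyCovered H u ≡ false → criticallyCovered H v ≡ false → isEdge H (u , v) ≡ true → ⊥
      extend {u} {v} u∉ v∉ ie = maximal (u , v) ie (λ e∈ → true≢false (Joined⇒covered H {M = C} (inj₁ e∈)) u∉)
        (Matching-∷ H C ie C-matching λ w c → case covers⁻ H {u} {v} c of λ where
          (inj₁ refl) → u∉
          (inj₂ refl) → v∉)
      add : isEdge H (x , p x) ≡ true ⊎ isEdge H (p x , x) ≡ true → ⊥
      add (inj₁ ie) = extend x∉ px∉ ie
      add (inj₂ ie) = extend px∉ x∉ ie

    unique⇔covered : UniquePerfectMatching H ⇔ AllCovered
    unique⇔covered = mk⇔ unique⇒covered covered⇒unique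

    unique⇔maximal : UniquePerfectMatching H ⇔ MaximalMatching H C
    unique⇔maximal = mk⇔ (covered⇒maximal ∘ unique⇒covered) (covered⇒unique ∘ maximal⇒covered)

    covered⇔count : AllCovered ⇔ (count (criticallyCovered H) ≡ n)
    covered⇔count = mk⇔
      (λ cov → trans (count-cong {f = criticallyCovered H} {g = λ _ → true} cov) (count-true n))
      (λ e x → ⟦⟧-injective (sum-squeeze {g = λ _ → 1} (λ x → ⟦⟧-mono {b = true} λ _ → refl)
                 (≤-reflexive (trans (count-true n) (sym e))) x))

-- The core, the vertices in no maximum stable set, and G₀

module KE (G : Graph n) (α+μ≡n : KonigEgervary G) where

  M : List (Edge n)
  M = proj₁ (maxMatching-exists G)

  M-matching : Matching G M
  M-matching = proj₁ (proj₂ (maxMatching-exists G))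

  q : Fin n → Fin n
  q = mate M

  ke : KEInvolution G q
  ke = record
    { matching = mate-matching G M M-matching
    ; maximum  = ≤-reflexive (begin
        2 * n                       ≡⟨ cong (2 *_) α+μ≡n ⟨
        2 * (α G + μ G)             ≡⟨ ℕₚ.*-distribˡ-+ 2 (α G) (μ G) ⟩
        2 * α G + 2 * μ G           ≡⟨ cong (λ l → 2 * α G + 2 * l) (proj₂ (proj₂ (maxMatching-exists G))) ⟨
        2 * α G + 2 * length M      ≡⟨ cong (2 * α G +_) (count-moved-mate G M M-matching) ⟨
        2 * α G + count (moved q)   ∎)
    }
    where open ≡-Reasoning

  core never keep : Fin n → Bool
  core  = inCore G
  never = inNoMaxStable G
  keep  = λ v → not (inClosedNbhdCore G v)

  core-never-disjoint : ∀ {x} → core x ≡ true → never x ≡ true → ⊥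
  core-never-disjoint c d = let f , ms = maxStable-exists G in true≢false (inCore⁻ G c ms) (inNoMaxStable⁻ G d ms)

  -- The mate of a vertex lying in no maximum stable set lies in all of them.
  closedNbhd≡ : ∀ x → inClosedNbhdCore G x ≡ core x ∨ never x
  closedNbhd≡ x = bool-ext to from
    where
    to : inClosedNbhdCore G x ≡ true → core x ∨ never x ≡ true
    to h with ∨-true⁻ (core x) h
    ... | inj₁ c = ∨-true⁺ˡ _ c
    ... | inj₂ e = let u , uc = anyV-true⁻ (λ u → core u ∧ adj G u x) e ; c , a = ∧-true⁻ (core u) uc in
      ∨-true⁺ʳ (core x) (inNoMaxStable⁺ G λ ms → ≢true⇒≡false λ fx → true≢false a (proj₁ ms u x (inCore⁻ G c ms) fx))
    from : core x ∨ never x ≡ true → inClosedNbhdCore G x ≡ true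
    from h with ∨-true⁻ (core x) h
    ... | inj₁ c = ∨-true⁺ˡ _ c
    ... | inj₂ d = ∨-true⁺ʳ (core x) (anyV-true⁺ (λ u → core u ∧ adj G u x) (q x)
      (∧-true⁺ (inCore⁺ G λ ms → proj₁ (mated ms)) (adj-flip G (proj₂ (mated (proj₂ (maxStable-exists G)))))))
      where
      mated : ∀ {f} → MaxStable G f → f (q x) ≡ true × adj G x (q x) ≡ true
      mated ms = outside⇒mate-inside G ke ms (inNoMaxStable⁻ G d ms)

  keep≡ : ∀ x → keep x ≡ not (core x ∨ never x)
  keep≡ x = cong not (closedNbhd≡ x)

  partition : ∀ x → 1 ≡ ⟦ core x ⟧ + (⟦ never x ⟧ + ⟦ keep x ⟧)
  partition x rewrite keep≡ x with core x in c | never x in d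
  ... | true  | true  = ⊥-elim (core-never-disjoint c d)
  ... | true  | false = refl
  ... | false | true  = refl
  ... | false | false = refl

  keep⁻ : ∀ {x} → keep x ≡ true → core x ≡ false × never x ≡ false
  keep⁻ {x} h with core x | never x | trans (sym (keep≡ x)) h
  ... | false | false | _ = refl , refl

  keep⁺ : ∀ {x} → core x ≡ false → never x ≡ false → keep x ≡ true
  keep⁺ {x} c d = trans (keep≡ x) (cong₂ (λ a b → not (a ∨ b)) c d)

  keep-intro : ∀ {x} → (∃ λ f → MaxStable G f × f x ≡ false) → (∃ λ f → MaxStable G f × f x ≡ true) → keep x ≡ true
  keep-intro (f , ms , fx) (f′ , ms′ , fx′) = keep⁺
    (≢true⇒≡false λ c → true≢false (inCore⁻ G c ms) fx)
    (≢true⇒≡false λ d → true≢false fx′ (inNoMaxStable⁻ G d ms′))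

  kept-avoided : ∀ {x} → keep x ≡ true → ∃ λ f → MaxStable G f × f x ≡ false
  kept-avoided h = inCore-false⁻ G (proj₁ (keep⁻ h))

  kept-included : ∀ {x} → keep x ≡ true → ∃ λ f → MaxStable G f × f x ≡ true
  kept-included h = inNoMaxStable-false⁻ G (proj₂ (keep⁻ h))

  mate-adjacent : ∀ {x} → keep x ≡ true → adj G x (q x) ≡ true
  mate-adjacent h = let f , ms , fx = kept-avoided h in proj₂ (outside⇒mate-inside G ke ms fx)

  mate-flips : ∀ {f x} → MaxStable G f → keep x ≡ true → f (q x) ≡ not (f x)
  mate-flips {f} {x} ms h with f x in e
  ... | true  = ≢true⇒≡false λ e′ → true≢false (mate-adjacent h) (proj₁ ms x (q x) e e′)
  ... | false = proj₁ (outside⇒mate-inside G ke ms e)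

  -- A vertex is kept when some maximum stable set contains it and another avoids it; passing to the
  -- mate swaps these two roles.
  mate-keep : ∀ {x} → keep x ≡ true → keep (q x) ≡ true
  mate-keep h = let f , ms , fx = kept-avoided h ; f′ , ms′ , fx′ = kept-included h in
    keep-intro (f′ , ms′ , trans (mate-flips ms′ h) (cong not fx′)) (f , ms , trans (mate-flips ms h) (cong not fx))

  open Induced G keep public

  H : Graph m
  H = G₀ G

  p : Fin m → Fin m
  p i = proj₁ (ι-surjective (mate-keep (ι-kept i)))

  ι-p : ∀ i → ι (p i) ≡ q (ι i)
  ι-p i = proj₂ (ι-surjective (mate-keep (ι-kept i)))

  p-perfect : PerfectInvolution H p
  p-perfect = record
    { p-involutive = λ i → ι-injective (trans (ι-p (p i)) (trans (cong q (ι-p i)) (involutive (matching ke) (ι i))))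
    ; p-adjacent   = λ i → trans (cong (adj G (ι i)) (ι-p i)) (mate-adjacent (ι-kept i))
    }

  maxStable-restrict : ∀ {f} → MaxStable G f → count (f ∘ ι) + count (f ∘ ι) ≡ m
  maxStable-restrict {f} ms = count-flips {p = p} (p-involutive p-perfect) (f ∘ ι)
    (λ i → trans (cong f (ι-p i)) (mate-flips ms (ι-kept i)))

  maxStable-split : ∀ {f} → MaxStable G f → count f ≡ count core + count (f ∘ ι)
  maxStable-split {f} ms = trans
    (count-split {f = f} {core} {λ x → keep x ∧ f x} split)
    (cong (count core +_) (sym (count-ι f)))
    where
    split : ∀ x → ⟦ f x ⟧ ≡ ⟦ core x ⟧ + ⟦ keep x ∧ f x ⟧
    split x rewrite keep≡ x with core x in c | never x in d
    ... | true  | _     rewrite inCore⁻ G c ms = refl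
    ... | false | true  rewrite inNoMaxStable⁻ G d ms = refl
    ... | false | false = refl

  -- Sets of G₀ return to `G` with the core added. Neighbours of the core were deleted, so no edge
  -- arises between the two parts.
  extend : (Fin m → Bool) → Fin n → Bool
  extend g x = core x ∨ lift g x

  count-extend : ∀ g → count (extend g) ≡ count core + count g
  count-extend g = trans (count-split {f = extend g} {core} {lift g} disjoint) (cong (count core +_) (count-lift g))
    where
    disjoint : ∀ x → ⟦ extend g x ⟧ ≡ ⟦ core x ⟧ + ⟦ lift g x ⟧
    disjoint x with core x in c | lift g x in l
    ... | true  | true  = ⊥-elim (true≢false c (proj₁ (keep⁻ (lift-kept g l))))
    ... | true  | false = refl
    ... | false | _     = refl

  extend-core-isolated : ∀ g {x y} → core x ≡ true → extend g y ≡ true → adj G x y ≡ false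
  extend-core-isolated g {x} {y} cx ey with ∨-true⁻ (core y) ey
  ... | inj₁ cy = let f , ms = maxStable-exists G in proj₁ ms x y (inCore⁻ G cx ms) (inCore⁻ G cy ms)
  ... | inj₂ ly = ≢true⇒≡false λ a → true≢false
    (∨-true⁺ʳ (core y) (anyV-true⁺ (λ u → core u ∧ adj G u y) x (∧-true⁺ cx a)))
    (not-true⁻ (lift-kept g ly))

  extend-adjacent : ∀ g {x y} → extend g x ≡ true → extend g y ≡ true → adj G x y ≡ true →
                    ∃ λ i → ∃ λ j → (ι i ≡ x × g i ≡ true) × (ι j ≡ y × g j ≡ true)
  extend-adjacent g {x} {y} ex ey a with ∨-true⁻ (core x) ex | ∨-true⁻ (core y) ey
  ... | inj₁ cx | _       = ⊥-elim (true≢false a (extend-core-isolated g cx ey))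
  ... | inj₂ _  | inj₁ cy = ⊥-elim (true≢false (adj-flip G a) (extend-core-isolated g cy ex))
  ... | inj₂ lx | inj₂ ly = let i , x′ = lift⁻ g lx ; j , y′ = lift⁻ g ly in i , j , x′ , y′

  -- Upper bound: a maximum stable set of `G` consists of the core and a stable set of `H`. Lower
  -- bound: a maximum stable set of `H` remains stable when the core is added.
  α≡ξ+αH : α G ≡ count core + α H
  α≡ξ+αH = ≤-antisym
    (let f , ms = maxStable-exists G in
      subst (_≤ count core + α H) (trans (sym (maxStable-split ms)) (MaxStable⇒count≡α G ms))
        (+-monoʳ-≤ (count core) (Stable⇒count≤α H (λ i j → proj₁ ms (ι i) (ι j)))))
    (let g , st , le = maxStable-exists H in
      ≤-trans (+-monoʳ-≤ (count core) le) (subst (_≤ α G) (count-extend g) (Stable⇒count≤α G (extend-stable st))))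
    where
    extend-stable : ∀ {g} → Stable H g → Stable G (extend g)
    extend-stable {g} st x y ex ey = ≢true⇒≡false λ a → case extend-adjacent g ex ey a of λ where
      (i , j , (refl , gi) , (refl , gj)) → true≢false a (st i j gi gj)

  restrict-maxStable : ∀ {f} → MaxStable G f → MaxStable H (f ∘ ι)
  restrict-maxStable {f} ms = (λ i j → proj₁ ms (ι i) (ι j)) ,
    +-cancelˡ-≤ (count core) _ _ (subst₂ _≤_ α≡ξ+αH (maxStable-split ms) (proj₂ ms))

  2αH≡m : α H + α H ≡ m
  2αH≡m = let f , ms = maxStable-exists G in
    subst (λ a → a + a ≡ m) (MaxStable⇒count≡α H (restrict-maxStable ms)) (maxStable-restrict ms)

  -- Adding the core raises the size of the witness and the stability number by the same amount and
  -- creates no edge.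
  Critical-lift : ∀ {i j} → Critical H i j → Critical G (ι i) (ι j)
  Critical-lift {i} {j} c = record
    { edge    = edge c
    ; set     = extend (set c)
    ; set-fst = ∨-true⁺ʳ (core (ι i)) (lift⁺ (set c) i (set-fst c))
    ; set-snd = ∨-true⁺ʳ (core (ι j)) (lift⁺ (set c) j (set-snd c))
    ; large   = subst₂ _<_ (sym α≡ξ+αH) (sym (count-extend (set c))) (ℕₚ.+-monoʳ-< (count core) (large c))
    ; almost  = λ ex ey a → case extend-adjacent (set c) ex ey a of λ where
        (_ , _ , (refl , gi) , (refl , gj)) →
          Sum.map (λ { (refl , refl) → refl , refl }) (λ { (refl , refl) → refl , refl }) (almost c gi gj a)
    }

  -- Deleting one end or the other from the witness gives a maximum stable set avoiding `x` and one
  -- containing it.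
  Critical-kept : ∀ {x y} → Critical G x y → keep x ≡ true
  Critical-kept c = keep-intro (Critical-avoid G c) (Critical-include G c)

  Critical-restrict : ∀ {i j} → Critical G (ι i) (ι j) → Critical H i j
  Critical-restrict {i} {j} c = record
    { edge    = edge c
    ; set     = set c ∘ ι
    ; set-fst = set-fst c
    ; set-snd = set-snd c
    -- Without `ι i` the witness is a maximum stable set of `G`, so its restriction has at least
    -- `α H` vertices; putting `i` back adds one.
    ; large   = subst (α H <_) (sym (count-remove (set c ∘ ι) i (set-fst c)))
                  (s≤s (≤-trans (proj₂ (restrict-maxStable (Critical-remove G c))) (≤-reflexive (count-cong same))))
    ; almost  = λ a b e → Sum.map (λ (d , d′) → ι-injective d , ι-injective d′)
                                  (λ (d , d′) → ι-injective d , ι-injective d′) (almost c a b e)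
    }
    where
    same : ∀ x → remove (set c) (ι i) (ι x) ≡ remove (set c ∘ ι) i x
    same x = cong (λ b → set c (ι x) ∧ not b) (bool-ext (==-true⁺ ∘ ι-injective ∘ ==-true⁻) (==-true⁺ ∘ cong ι ∘ ==-true⁻))

  criticallyCovered-ι : ∀ i → criticallyCovered G (ι i) ≡ criticallyCovered H i
  criticallyCovered-ι i = bool-ext to from
    where
    to : criticallyCovered G (ι i) ≡ true → criticallyCovered H i ≡ true
    to h = let y , c = criticallyCovered⁻ G h
               j , e = ι-surjective (Critical-kept (Critical-sym G c))
           in criticallyCovered⁺ H (Critical-restrict (subst (Critical G (ι i)) (sym e) c))
    from : criticallyCovered H i ≡ true → criticallyCovered G (ι i) ≡ true
    from h = criticallyCovered⁺ G (Critical-lift (proj₂ (criticallyCovered⁻ H h)))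

  -- The critical edges of `G` form a matching and so cover `2 * η G` vertices. All of these are
  -- kept, and a kept vertex is covered in `G` exactly when it is covered in `H`.
  2η≡covered : 2 * η G ≡ count (criticallyCovered H)
  2η≡covered = begin
    2 * η G                         ≡⟨ count-covered G (criticalEdges G) (criticalEdges-matching G ke) ⟨
    count (criticallyCovered G)     ≡⟨ count-within {criticallyCovered G} (Critical-kept ∘ proj₂ ∘ criticallyCovered⁻ G) ⟩
    count (criticallyCovered G ∘ ι) ≡⟨ count-cong {f = criticallyCovered G ∘ ι} criticallyCovered-ι ⟩
    count (criticallyCovered H)     ∎
    where open ≡-Reasoning

  α≡ : α G ≡ ξ G + α H
  α≡ = trans α≡ξ+αH (cong (_+ α H) (sym (countV≡count core)))

  n≡ : n ≡ ξ G + (σ G + (α H + α H))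
  n≡ = begin
    n                                             ≡⟨ count-true n ⟨
    count {n} (λ _ → true)                        ≡⟨ sum-cong-≗ partition ⟩
    sum (λ x → ⟦ core x ⟧ + (⟦ never x ⟧ + ⟦ keep x ⟧)) ≡⟨ ∑-distrib-+ (⟦_⟧ ∘ core) (λ x → ⟦ never x ⟧ + ⟦ keep x ⟧) ⟩
    count core + sum (λ x → ⟦ never x ⟧ + ⟦ keep x ⟧) ≡⟨ cong (count core +_) (∑-distrib-+ (⟦_⟧ ∘ never) (⟦_⟧ ∘ keep)) ⟩
    count core + (count never + count keep)
      ≡⟨ cong₂ (λ a b → a + (b + count keep)) (countV≡count core) (countV≡count never) ⟨
    ξ G + (σ G + count keep)
      ≡⟨ cong (λ k → ξ G + (σ G + k)) (trans (sym (length-filter keep (λ x → x))) (sym 2αH≡m)) ⟩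
    ξ G + (σ G + (α H + α H))                     ∎
    where open ≡-Reasoning

  μ≡ : μ G ≡ σ G + α H
  μ≡ = +-cancelˡ-≡ (α G) (μ G) (σ G + α H) (begin
    α G + μ G                 ≡⟨ α+μ≡n ⟩
    n                         ≡⟨ n≡ ⟩
    ξ G + (σ G + (α H + α H)) ≡⟨ rearrange (ξ G) (σ G) (α H) ⟩
    ξ G + α H + (σ G + α H)   ≡⟨ cong (_+ (σ G + α H)) α≡ ⟨
    α G + (σ G + α H)         ∎)
    where
    open ≡-Reasoning
    rearrange : ∀ a b c → a + (b + (c + c)) ≡ a + c + (b + c)
    rearrange = solve-∀

  private
    some-included : ∀ i → ∃ λ S → MaxStable H S × S i ≡ true
    some-included i = let f , ms , fx = kept-included (ι-kept i) in f ∘ ι , restrict-maxStable ms , fx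

    some-avoided : ∀ i → ∃ λ S → MaxStable H S × S i ≡ false
    some-avoided i = let f , ms , fx = kept-avoided (ι-kept i) in f ∘ ι , restrict-maxStable ms , fx

  unique⇔maximalCritical : UniquePerfectMatching H ⇔ MaximalMatching H (criticalEdges H)
  unique⇔maximalCritical = unique⇔maximal H 2αH≡m (p , p-perfect) some-included some-avoided

  -- Covering all `m` vertices of `H` means that `2 * η G` equals `m`, which is `2 * α H`. The three
  -- numerical conditions are all reduced to this equality.
  unique⇔η≡αH : UniquePerfectMatching H ⇔ (η G ≡ α H)
  unique⇔η≡αH = mk⇔
    (λ u → ℕₚ.*-cancelˡ-≡ (η G) (α H) 2 (trans 2η≡covered (trans (to covered⇔ (to unique⇔ u)) (sym double))))
    (λ e → from unique⇔ (from covered⇔ (trans (sym 2η≡covered) (trans (cong (2 *_) e) double))))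
    where
    open Equivalence
    double : 2 * α H ≡ m
    double = trans (cong (α H +_) (ℕₚ.+-identityʳ (α H))) 2αH≡m
    unique⇔  = unique⇔covered H 2αH≡m (p , p-perfect) some-included some-avoided
    covered⇔ = covered⇔count H 2αH≡m (p , p-perfect) some-included some-avoided

theorem4p2 : (n : ℕ) (G : Graph n) → Connected G → HasEdge G → KonigEgervary G →
    ((UniquePerfectMatching (G₀ G) ⇔ MaximalMatching (G₀ G) (criticalEdges (G₀ G)))
    × (UniquePerfectMatching (G₀ G) ⇔ (ξ G + η G ≡ α G))
    × (UniquePerfectMatching (G₀ G) ⇔ (σ G + η G ≡ μ G))
    × (UniquePerfectMatching (G₀ G) ⇔ (ξ G + 2 * η G + σ G ≡ n)))
theorem4p2 n G _ _ α+μ≡n =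
    unique⇔maximalCritical
  -- Substituting `α≡` and cancelling `ξ G` turns (iii) into `η G ≡ α H`; (iv) and (v) are treated
  -- alike with `μ≡` and `n≡′`.
  , mk⇔ (λ u → trans (cong (ξ G +_) (to unique⇔η≡αH u)) (sym α≡))
        (λ e → from unique⇔η≡αH (+-cancelˡ-≡ (ξ G) (η G) (α H) (trans e α≡)))
  , mk⇔ (λ u → trans (cong (σ G +_) (to unique⇔η≡αH u)) (sym μ≡))
        (λ e → from unique⇔η≡αH (+-cancelˡ-≡ (σ G) (η G) (α H) (trans e μ≡)))
  , mk⇔ (λ u → trans (cong (λ k → ξ G + 2 * k + σ G) (to unique⇔η≡αH u)) (sym n≡′))
        (λ e → from unique⇔η≡αH (ℕₚ.*-cancelˡ-≡ (η G) (α H) 2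
          (+-cancelˡ-≡ (ξ G) (2 * η G) (2 * α H) (ℕₚ.+-cancelʳ-≡ (σ G) (ξ G + 2 * η G) (ξ G + 2 * α H) (trans e n≡′)))))
  where
  open KE G α+μ≡n
  open Equivalence
  rearrange : ∀ a b c → a + (b + (c + c)) ≡ a + 2 * c + b
  rearrange = solve-∀
  n≡′ : n ≡ ξ G + 2 * α H + σ G
  n≡′ = trans n≡ (rearrange (ξ G) (σ G) (α H))
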